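{- Let $\mathcal Q$ be a unary query on $p$-labelled graphs that is computable by a rational piecewise linear GNN. Then $\mathcal Q$ is definable in $\mathsf{GFO{+}C}$.
   Context: Graphs are finite, simple, undirected, with nonempty vertex set. A $p$-labelled graph is $(G,\mathbf b)$ with $\mathbf b:V(G)\to\{0,1\}^p$. A unary query $\mathcal Q$ assigns to each $(G,\mathbf b)$ a map $\mathcal Q(G,\mathbf b):V(G)\to\{0,1\}$, invariant under label-preserving isomorphisms. A dyadic rational is a rational whose denominator is a power of $2$. A piecewise linear function $L:\mathbb R\to\mathbb R$ (finitely many pieces) is rational if all thresholds, slopes and constant terms of its minimal representation are dyadic rationals. An FNN $\mathfrak F=(V,E,(\mathfrak a_v),(w_e),(b_v))$ has a finite dag skeleton, activations $\mathfrak a_v$, weights $w_e$, biases $b_v$; sources are inputs, sinks outputs; a non-input node computes $\mathfrak a_v(b_v+\sum_{uv\in E}w_{uv}\cdot\text{value}(u))$. It is rational piecewise linear if all weights and biases are dyadic rationals and all activations are continuous rational piecewise linear functions. A GNN layer $(\mathrm{msg},\mathrm{agg},\mathrm{comb})$, with $\mathrm{msg},\mathrm{comb}$ computed by FNNs and $\mathrm{agg}\in\{$sum, mean, max$\}$ (coordinatewise, $\mathbf 0$ on empty multisets), maps $\mathcal x:V(G)\to\mathbb R^p$ to $\mathcal y(v)=\mathrm{comb}(\mathcal x(v),\mathrm{agg}\{\!\{\mathrm{msg}(\mathcal x(v),\mathcal x(w)):w\in N(v)\}\!\})$. A GNN is a finite composition of layers; $\tilde{\mathfrak N}(G,\mathcal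 x)$ is its output signal. It is rational piecewise linear if all its FNNs are. A GNN $\mathfrak N$ (input dimension $p$, output dimension $1$) computes $\mathcal Q$ if for all $(G,\mathbf b)$ and $v$: $\tilde{\mathfrak N}(G,\mathbf b)(v)\ge3/4$ if $\mathcal Q(G,\mathbf b)(v)=1$ and $\le1/4$ if $\mathcal Q(G,\mathbf b)(v)=0$. Logic: $(G,\mathbf b)$ is the structure with universe $V(G)$, binary $E$, unary $P_i=\{v:\mathbf b(v)_i=1\}$. Two sorts: vertex variables (over $V(G)$) and number variables (over $\mathbb N$). $\mathsf{GFO{+}C}$ uses only vertex variables $x_1,x_2$. Terms: number variables, $0$, $1$, $\mathrm{ord}$ (value $|V(G)|$), $\theta+\theta'$, $\theta\cdot\theta'$, counting terms. Formulas: $\theta\le\theta'$, $E(x_i,x_j)$, $P_k(x_i)$, $x_i=x_j$, $\neg\varphi$, $\varphi\wedge\psi$. Counting terms: $\#(x_{3-i},y_1<\theta_1,\dots,y_k<\theta_k).(\gamma\wedge\varphi)$ with guard $\gamma$ equal to $E(x_i,x_{3-i})$ or $E(x_{3-i},x_i)$, and $\#(y_1<\theta_1,\dots,y_k<\theta_k).\varphi$. A counting term $\#(z_1..z_m,y_1<\theta_1,..,y_k<\theta_k).\psi$ evaluates to the number of tuples $(c_1..c_m,b_1..b_k)$ of vertices and naturals with each $b_j$ below the value of $\theta_j$ under the assignment extended by $z\mapsto c$, $y_1..y_{j-1}\mapsto b_1..b_{j-1}$, and satisfying $\psi$ under the assignment extended by all of them (these variables become bound). $\mathcal Q$ is definable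 in $\mathsf{GFO{+}C}$ if there is a formula $\varphi(x_1)$ with only free variable $x_1$ such that $(G,\mathbf b)\models\varphi(v)\iff\mathcal Q(G,\mathbf b)(v)=1$ for all $(G,\mathbf b),v$. -}

module Defs where

open import Data.Bool using (Bool; true; false; T; not; _∧_; if_then_else_)
open import Data.Empty using (⊥)
open import Data.Fin using (Fin)
open import Data.Fin.Patterns using (0F)
import Data.Fin.Properties as Fin
open import Data.Fin.Induction using (spo-wellFounded)
open import Data.Integer using (+_)
open import Data.List
  using (List; []; _∷_; map; foldr; length; allFin; upTo; concatMap; filterᵇ)
open import Data.List.Relation.Unary.All using (All)
open import Data.List.Relation.Unary.Linked using (Linked)
open import Data.Nat as ℕ using (ℕ; suc; NonZero)
open import Data.Product using (Σ-syntax; ∃-syntax; _×_; _,_; proj₁)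
open import Data.Rational as ℚ
  using (ℚ; 0ℚ; 1ℚ; _/_; _⊔_; ∣_∣; ↧ₙ_; _≤_; _<_; _<?_)
open import Data.Sum using (_⊎_)
open import Data.Vec.Functional using (Vector; _++_)
open import Function.Bundles using (_↔_; _⇔_; Inverse)
open import Function.Definitions using (Injective)
open import Induction.WellFounded using (Acc; acc; WellFounded)
open import Relation.Binary.Construct.Closure.ReflexiveTransitive using (Star; ε; _◅_)
open import Relation.Binary.Construct.Closure.Transitive
  using (TransClosure; wellFounded⁻) renaming (_++_ to _++⁺_)
open import Relation.Binary.PropositionalEquality
  using (_≡_; _≢_; refl; isEquivalence)
open import Relation.Nullary using (¬_; Dec; yes; no)
open import Relation.Nullary.Decidable using (⌊_⌋; T?)

------------------------------------------------------------------------
-- Labelled graphs and unary queries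

-- Vertex sets are of the form Fin n. Since queries are invariant under
-- isomorphism, this loses no finite graph.
record LGraph (p : ℕ) : Set where
  field
    order       : ℕ
    nonempty    : NonZero order
    adj         : Fin order → Fin order → Bool
    adj-sym     : ∀ u v → adj u v ≡ adj v u
    adj-irrefl  : ∀ v → adj v v ≡ false
    label       : Fin order → Vector Bool p

  V : Set
  V = Fin order

open LGraph public using (V; order; adj; label)

record _≅_ {p : ℕ} (G H : LGraph p) : Set where
  field
    bijection : V G ↔ V H

  to : V G → V H
  to = Inverse.to bijection

  field
    to-adj   : ∀ u v → adj H (to u) (to v) ≡ adj G u v
    to-label : ∀ v i → label H (to v) i ≡ label G v i

record UnaryQuery (p : ℕ) : Set where
  field
    answer    : (G : LGraph p) → V G → Bool
    invariant : ∀ {G H} (f : G ≅ H) (v : V G) → answer H (_≅_.to f v) ≡ answer G v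

open UnaryQuery public using (answer)

------------------------------------------------------------------------
-- Rational piecewise linear functions
--
-- All functions are taken on ℚ instead of ℝ. A piecewise linear function
-- with rational coefficients is determined by its restriction to ℚ, which
-- maps ℚ to ℚ, and (its thresholds being rational) it is continuous iff the
-- restriction is. A network with such activations and rational weights, on
-- {0,1}-valued inputs and with sum, mean and max aggregation, never leaves ℚ.

Dyadic : ℚ → Set
Dyadic x = ∃[ k ] ↧ₙ x ≡ 2 ℕ.^ k

record Affine : Set where
  constructor affine
  field
    slope const : ℚ

  at : ℚ → ℚ
  at x = slope ℚ.* x ℚ.+ const

  DyadicAffine : Set
  DyadicAffine = Dyadic slope × Dyadic const

open Affine public using (at; DyadicAffine)

evalFrom : Affine → List (ℚ × Affine) → ℚ → ℚ
evalFrom a []              x = at a x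
evalFrom a ((t , a′) ∷ ps) x = if ⌊ x <? t ⌋ then at a x else evalFrom a′ ps x

-- first applies below the first threshold; each later piece (t , a) applies
-- from t (included) up to the next threshold (excluded).
record Representation : Set where
  constructor representation
  field
    first      : Affine
    rest       : List (ℚ × Affine)
    increasing : Linked _<_ (map proj₁ rest)

  eval : ℚ → ℚ
  eval = evalFrom first rest

  DyadicRepresentation : Set
  DyadicRepresentation =
    DyadicAffine first × All (λ (t , a) → Dyadic t × DyadicAffine a) rest

open Representation public using (rest; eval; DyadicRepresentation)

_Represents_ : Representation → (ℚ → ℚ) → Set
r Represents f = ∀ x → f x ≡ eval r x

_MinimallyRepresents_ : Representation → (ℚ → ℚ) → Set
r MinimallyRepresents f =
  r Represents f × (∀ s → s Represents f → length (rest r) ℕ.≤ length (rest s))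

RationalPL : (ℚ → ℚ) → Set
RationalPL f = ∃[ r ] r MinimallyRepresents f × DyadicRepresentation r

Continuous : (ℚ → ℚ) → Set
Continuous f =
  ∀ x ε → 0ℚ < ε →
  ∃[ δ ] 0ℚ < δ × (∀ y → ∣ y ℚ.- x ∣ < δ → ∣ f y ℚ.- f x ∣ < ε)

------------------------------------------------------------------------
-- Feedforward neural networks

sumℚ : List ℚ → ℚ
sumℚ = foldr ℚ._+_ 0ℚ

record FNN (p q : ℕ) : Set where
  field
    size : ℕ

  Node : Set
  Node = Fin size

  field
    edge : Node → Node → Bool

  Edge : Node → Node → Set
  Edge u v = T (edge u v)

  IsSource : Node → Set
  IsSource v = ∀ u → ¬ Edge u v

  IsSink : Node → Set
  IsSink v = ∀ u → ¬ Edge v u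

  -- input and output enumerate the sources and the sinks without repetition.
  field
    acyclic          : ∀ v → ¬ TransClosure Edge v v
    input            : Fin p → Node
    input-injective  : Injective _≡_ _≡_ input
    input-sources    : ∀ v → IsSource v ⇔ (∃[ i ] input i ≡ v)
    output           : Fin q → Node
    output-injective : Injective _≡_ _≡_ output
    output-sinks     : ∀ v → IsSink v ⇔ (∃[ i ] output i ≡ v)
    activation       : Node → ℚ → ℚ
    weight           : ∀ u v → Edge u v → ℚ
    bias             : Node → ℚ

  Edge-wellFounded : WellFounded Edge
  Edge-wellFounded = wellFounded⁻ Edge (spo-wellFounded record
    { isEquivalence = isEquivalence
    ; irrefl        = λ { refl c → acyclic _ c }
    ; trans         = _++⁺_
    ; <-resp-≈      = (λ { refl c → c }) , (λ { refl c → c })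
    })

  -- Recursion along the edges. The sum runs over all nodes u; those without
  -- an edge to v contribute 0.
  mutual
    valueAcc : Vector ℚ p → ∀ v → Acc Edge v → ℚ
    valueAcc x v (acc rs) with Fin.any? (λ i → input i Fin.≟ v)
    ... | yes (i , _) = x i
    ... | no  _       =
      activation v (bias v ℚ.+ sumℚ (map (λ u → contribution x v rs u (T? (edge u v))) (allFin size)))

    contribution : Vector ℚ p → ∀ v → (∀ {u} → Edge u v → Acc Edge u) →
                   ∀ u → Dec (Edge u v) → ℚ
    contribution x v rs u (yes e) = weight u v e ℚ.* valueAcc x u (rs e)
    contribution x v rs u (no  _) = 0ℚ

  value : Vector ℚ p → Node → ℚ
  value x v = valueAcc x v (Edge-wellFounded v)

  compute : Vector ℚ p → Vector ℚ q
  compute x j = value x (output j)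

  RationalPLFNN : Set
  RationalPLFNN =
      (∀ u v e → Dyadic (weight u v e))
    × (∀ v → Dyadic (bias v))
    × (∀ v → Continuous (activation v) × RationalPL (activation v))

open FNN public using (compute; RationalPLFNN)

------------------------------------------------------------------------
-- Graph neural networks

data Aggregator : Set where
  sum mean max : Aggregator

aggregate : Aggregator → List ℚ → ℚ
aggregate sum  xs       = sumℚ xs
aggregate mean []       = 0ℚ
aggregate mean (x ∷ xs) = sumℚ (x ∷ xs) ℚ.* (+ 1 / suc (length xs))
aggregate max  []       = 0ℚ
aggregate max  (x ∷ xs) = foldr _⊔_ x xs

aggregateVectors : ∀ {q} → Aggregator → List (Vector ℚ q) → Vector ℚ q
aggregateVectors a xs i = aggregate a (map (λ x → x i) xs)

record Layer (p r : ℕ) : Set where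
  field
    {q}  : ℕ
    msg  : FNN (p ℕ.+ p) q
    agg  : Aggregator
    comb : FNN (p ℕ.+ q) r

Signal : ∀ {p} → LGraph p → ℕ → Set
Signal G q = V G → Vector ℚ q

neighbours : ∀ {p} (G : LGraph p) → V G → List (V G)
neighbours G v = filterᵇ (adj G v) (allFin (order G))

runLayer : ∀ {ℓ p r} → Layer p r → (G : LGraph ℓ) → Signal G p → Signal G r
runLayer L G x v =
  compute comb (x v ++ aggregateVectors agg (map (λ w → compute msg (x v ++ x w)) (neighbours G v)))
  where open Layer L

-- Finite sequences of layers with matching dimensions, first layer leftmost.
GNN : ℕ → ℕ → Set
GNN = Star Layer

runGNN : ∀ {ℓ p r} → GNN p r → (G : LGraph ℓ) → Signal G p → Signal G r
runGNN ε       G x = x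
runGNN (L ◅ N) G x = runGNN N G (runLayer L G x)

data RationalPLGNN : ∀ {p r} → GNN p r → Set where
  ε   : ∀ {p} → RationalPLGNN {p} ε
  _◅_ : ∀ {p q r} {L : Layer p q} {N : GNN q r} →
        RationalPLFNN (Layer.msg L) × RationalPLFNN (Layer.comb L) →
        RationalPLGNN N → RationalPLGNN (L ◅ N)

labelSignal : ∀ {p} (G : LGraph p) → Signal G p
labelSignal G v i = if label G v i then 1ℚ else 0ℚ

output₁ : ∀ {p} → GNN p 1 → (G : LGraph p) → V G → ℚ
output₁ N G v = runGNN N G (labelSignal G) v 0F

Computes : ∀ {p} → GNN p 1 → UnaryQuery p → Set
Computes N Q = ∀ G v →
    (answer Q G v ≡ true  → + 3 / 4 ≤ output₁ N G v)
  × (answer Q G v ≡ false → output₁ N G v ≤ + 1 / 4)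

------------------------------------------------------------------------
-- The logic GFO+C

data VertexVar : Set where
  x₁ x₂ : VertexVar

other : VertexVar → VertexVar
other x₁ = x₂
other x₂ = x₁

data Var : Set where
  vertex : VertexVar → Var
  number : ℕ → Var

-- For the vertex variable i of the counting term, toOther is the guard
-- E(i, other i) and fromOther is the guard E(other i, i).
data Guard : Set where
  toOther fromOther : Guard

mutual
  -- y₁ < θ₁ , … , yₖ < θₖ
  Bounds : ℕ → Set
  Bounds p = List (ℕ × Term p)

  data Term (p : ℕ) : Set where
    var   : ℕ → Term p
    zero  : Term p
    one   : Term p
    ord   : Term p
    _⊕_   : Term p → Term p → Term p
    _⊗_   : Term p → Term p → Term p
    -- #(other i, ys).(γ ∧ φ)
    #ᵍ    : (i : VertexVar) (ys : Bounds p) (γ : Guard) (φ : Formula p) → Term p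
    #ⁿ    : (ys : Bounds p) (φ : Formula p) → Term p

  data Formula (p : ℕ) : Set where
    _≼_   : Term p → Term p → Formula p
    E     : VertexVar → VertexVar → Formula p
    P     : Fin p → VertexVar → Formula p
    _≐_   : VertexVar → VertexVar → Formula p
    ¬'_   : Formula p → Formula p
    _∧'_  : Formula p → Formula p → Formula p

-- Free occurrence. In FreeUnder the last argument says that the variable is
-- free in the body; y_j binds in θ_{j+1}, …, θ_k and in the body, but not
-- in θ_j itself.
mutual
  FreeT : ∀ {p} → Var → Term p → Set
  FreeT z (var y)       = z ≡ number y
  FreeT z zero          = ⊥
  FreeT z one           = ⊥
  FreeT z ord           = ⊥
  FreeT z (θ ⊕ θ′)      = FreeT z θ ⊎ FreeT z θ′
  FreeT z (θ ⊗ θ′)      = FreeT z θ ⊎ FreeT z θ′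
  FreeT z (#ᵍ i ys γ φ) =
    z ≢ vertex (other i) ×
    FreeUnder z ys (z ≡ vertex i ⊎ z ≡ vertex (other i) ⊎ FreeF z φ)
  FreeT z (#ⁿ ys φ)     = FreeUnder z ys (FreeF z φ)

  FreeUnder : ∀ {p} → Var → Bounds p → Set → Set
  FreeUnder z []             B = B
  FreeUnder z ((y , θ) ∷ ys) B = FreeT z θ ⊎ (z ≢ number y × FreeUnder z ys B)

  FreeF : ∀ {p} → Var → Formula p → Set
  FreeF z (θ ≼ θ′) = FreeT z θ ⊎ FreeT z θ′
  FreeF z (E i j)  = z ≡ vertex i ⊎ z ≡ vertex j
  FreeF z (P k i)  = z ≡ vertex i
  FreeF z (i ≐ j)  = z ≡ vertex i ⊎ z ≡ vertex j
  FreeF z (¬' φ)   = FreeF z φ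
  FreeF z (φ ∧' ψ) = FreeF z φ ⊎ FreeF z ψ

record Assignment {p : ℕ} (G : LGraph p) : Set where
  constructor assignment
  field
    vertexAt : VertexVar → V G
    numberAt : ℕ → ℕ

open Assignment public

_[_↦ᵛ_] : ∀ {p} {G : LGraph p} → Assignment G → VertexVar → V G → Assignment G
assignment ν μ [ x₁ ↦ᵛ c ] = assignment (λ { x₁ → c ; x₂ → ν x₂ }) μ
assignment ν μ [ x₂ ↦ᵛ c ] = assignment (λ { x₁ → ν x₁ ; x₂ → c }) μ

_[_↦ⁿ_] : ∀ {p} {G : LGraph p} → Assignment G → ℕ → ℕ → Assignment G
assignment ν μ [ y ↦ⁿ b ] = assignment ν (λ y′ → if ⌊ y′ ℕ.≟ y ⌋ then b else μ y′)

⟦_,_⟧ᵍ : ∀ {p} → VertexVar → Guard → {G : LGraph p} → Assignment G → Bool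
⟦ i , toOther   ⟧ᵍ {G} α = adj G (vertexAt α i) (vertexAt α (other i))
⟦ i , fromOther ⟧ᵍ {G} α = adj G (vertexAt α (other i)) (vertexAt α i)

-- extensions α ys lists, with one entry per admissible tuple (b₁ , … , bₖ),
-- the assignments α extended by y_j ↦ b_j.
mutual
  ⟦_⟧ᵗ : ∀ {p} → Term p → {G : LGraph p} → Assignment G → ℕ
  ⟦ var y ⟧ᵗ α = numberAt α y
  ⟦ zero ⟧ᵗ  α = 0
  ⟦ one ⟧ᵗ   α = 1
  ⟦ ord ⟧ᵗ {G} α = order G
  ⟦ θ ⊕ θ′ ⟧ᵗ α = ⟦ θ ⟧ᵗ α ℕ.+ ⟦ θ′ ⟧ᵗ α
  ⟦ θ ⊗ θ′ ⟧ᵗ α = ⟦ θ ⟧ᵗ α ℕ.* ⟦ θ′ ⟧ᵗ α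
  ⟦ #ᵍ i ys γ φ ⟧ᵗ {G} α =
    length (filterᵇ (λ β → ⟦ i , γ ⟧ᵍ β ∧ ⟦ φ ⟧ᶠ β)
      (concatMap (λ c → extensions (α [ other i ↦ᵛ c ]) ys) (allFin (order G))))
  ⟦ #ⁿ ys φ ⟧ᵗ α = length (filterᵇ ⟦ φ ⟧ᶠ (extensions α ys))

  extensions : ∀ {p} {G : LGraph p} → Assignment G → Bounds p → List (Assignment G)
  extensions α []             = α ∷ []
  extensions α ((y , θ) ∷ ys) =
    concatMap (λ b → extensions (α [ y ↦ⁿ b ]) ys) (upTo (⟦ θ ⟧ᵗ α))

  ⟦_⟧ᶠ : ∀ {p} → Formula p → {G : LGraph p} → Assignment G → Bool
  ⟦ θ ≼ θ′ ⟧ᶠ α = ⟦ θ ⟧ᵗ α ℕ.≤ᵇ ⟦ θ′ ⟧ᵗ α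
  ⟦ E i j ⟧ᶠ {G} α = adj G (vertexAt α i) (vertexAt α j)
  ⟦ P k i ⟧ᶠ {G} α = label G (vertexAt α i) k
  ⟦ i ≐ j ⟧ᶠ α = ⌊ vertexAt α i Fin.≟ vertexAt α j ⌋
  ⟦ ¬' φ ⟧ᶠ α = not (⟦ φ ⟧ᶠ α)
  ⟦ φ ∧' ψ ⟧ᶠ α = ⟦ φ ⟧ᶠ α ∧ ⟦ ψ ⟧ᶠ α

Definable : ∀ {p} → UnaryQuery p → Set
Definable {p} Q = Σ[ φ ∈ Formula p ]
    (∀ z → FreeF z φ → z ≡ vertex x₁)
  × (∀ G (v : V G) (α : Assignment G) → vertexAt α x₁ ≡ v →
       ⟦ φ ⟧ᶠ α ≡ true ⇔ answer Q G v ≡ true)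

{-# OPTIONS --safe #-}

-- Fixed-point arithmetic. A rational value at a vertex is represented by natural numbers as
-- (pos - neg) / den, where pos and neg are the values of terms in the vertex variables and den is
-- the value of a closed term; the values of terms are unrestricted naturals, so no bit-level
-- representation is needed. Sums over neighbours are counting terms #(x₂, y < θ).E(x₁, x₂), and
-- truncated subtraction, division and maxima are counts of the y below the intended value.
-- Addition, multiplication, x ↦ max(x, 0), sum and max aggregation preserve this form exactly.
-- Only mean does not, as the denominators of different vertices differ; its result is rounded.
-- A value is therefore approximated to within every tolerance e ≥ 1/S, S a closed term. A sum over
-- neighbours multiplies the error by at most the order of the graph, and a continuous piecewise
-- linear activation by a constant because it is composed of affine maps and max(x, 0); so the
-- errors are absorbed by passing to a larger S. In the end tolerance 1/8 separates 3/4 from 1/4.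

module Submission where

open import Defs
open import Data.Bool using (Bool; true; false; T; not; _∧_; if_then_else_)
open import Data.Bool.Properties using (T-≡)
open import Data.Empty using (⊥; ⊥-elim)
open import Data.Fin using (Fin; splitAt)
open import Data.Fin.Patterns using (0F)
import Data.Fin.Properties as Fin
open import Data.Integer as ℤ using (+_; -[1+_])
import Data.Integer.Properties as ℤ
open import Data.List
  using (List; []; _∷_; map; foldr; length; allFin; upTo; applyUpTo; concatMap; filterᵇ)
import Data.List.Properties as List
open import Data.List.Relation.Unary.All as All using (All; []; _∷_; universal)
open import Data.List.Relation.Unary.Linked using (Linked; _∷_)
open import Data.Nat as ℕ using (ℕ; zero; suc; NonZero; z≤n; s≤s)
import Data.Nat.DivMod as ℕ
open import Data.Nat.ListAction using () renaming (sum to ∑)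
import Data.Nat.Properties as ℕ
open import Data.Product using (Σ-syntax; _×_; _,_; proj₁; proj₂)
open import Data.Rational as ℚ
  using (ℚ; mkℚ; 0ℚ; 1ℚ; ½; _/_; _+_; _*_; _-_; -_; _⊔_; _⊓_; ∣_∣; ↥_; ↧ₙ_;
         _≤_; _<_; _<?_; toℚᵘ; NonNegative; Positive)
import Data.Rational.Properties as ℚ
open import Data.Rational.Solver using (module +-*-Solver)
import Data.Rational.Unnormalised as ℚᵘ
import Data.Rational.Unnormalised.Properties as ℚᵘ
open import Data.Sum using (_⊎_; inj₁; inj₂; [_,_]′)
open import Data.Unit using (⊤; tt)
open import Data.Vec.Functional using (Vector; _++_)
open import Function using (_∘_; const; id)
open import Function.Bundles using (_⇔_; mk⇔; Equivalence)
open import Induction.WellFounded using (Acc; acc)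
open import Relation.Binary.Construct.Closure.ReflexiveTransitive using (ε; _◅_)
open import Relation.Binary.Definitions using (tri<; tri≈; tri>)
open import Relation.Binary.PropositionalEquality
open import Relation.Nullary using (Dec; yes; no)
open import Relation.Nullary.Decidable using (T?)
open +-*-Solver using (solve; _:=_; _:+_; _:*_; _:-_; :-_; con)

private
  variable
    p : ℕ

-- Rational arithmetic and approximation

fromℕ : ℕ → ℚ
fromℕ n = + n / 1

-- `_/_` normalises its fraction, so the identities below are checked on unnormalised rationals,
-- where equality is cross-multiplication.
toℚᵘ-/ : ∀ i k → toℚᵘ (i / suc k) ℚᵘ.≃ ℚᵘ.mkℚᵘ i k
toℚᵘ-/ i k = ℚ.toℚᵘ-fromℚᵘ (ℚᵘ.mkℚᵘ i k)

fromℕ-+ : ∀ m n → fromℕ (m ℕ.+ n) ≡ fromℕ m + fromℕ n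
fromℕ-+ m n = ℚ.toℚᵘ-injective (begin
  toℚᵘ (fromℕ (m ℕ.+ n))                   ≈⟨ toℚᵘ-/ (+ (m ℕ.+ n)) 0 ⟩
  ℚᵘ.mkℚᵘ (+ (m ℕ.+ n)) 0                  ≈⟨ ℚᵘ.*≡* (cong (ℤ._* + 1) (cong₂ ℤ._+_ (ℤ.*-identityʳ (+ m)) (ℤ.*-identityʳ (+ n)))) ⟨
  ℚᵘ.mkℚᵘ (+ m) 0 ℚᵘ.+ ℚᵘ.mkℚᵘ (+ n) 0     ≈⟨ ℚᵘ.+-cong (toℚᵘ-/ (+ m) 0) (toℚᵘ-/ (+ n) 0) ⟨
  toℚᵘ (fromℕ m) ℚᵘ.+ toℚᵘ (fromℕ n)       ≈⟨ ℚ.toℚᵘ-homo-+ (fromℕ m) (fromℕ n) ⟨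
  toℚᵘ (fromℕ m + fromℕ n)                 ∎)
  where open ℚᵘ.≃-Reasoning

fromℕ-* : ∀ m n → fromℕ (m ℕ.* n) ≡ fromℕ m * fromℕ n
fromℕ-* m n = ℚ.toℚᵘ-injective (begin
  toℚᵘ (fromℕ (m ℕ.* n))                   ≈⟨ toℚᵘ-/ (+ (m ℕ.* n)) 0 ⟩
  ℚᵘ.mkℚᵘ (+ (m ℕ.* n)) 0                  ≈⟨ ℚᵘ.*≡* (cong (ℤ._* + 1) (ℤ.pos-* m n)) ⟩
  ℚᵘ.mkℚᵘ (+ m) 0 ℚᵘ.* ℚᵘ.mkℚᵘ (+ n) 0     ≈⟨ ℚᵘ.*-cong (toℚᵘ-/ (+ m) 0) (toℚᵘ-/ (+ n) 0) ⟨
  toℚᵘ (fromℕ m) ℚᵘ.* toℚᵘ (fromℕ n)       ≈⟨ ℚ.toℚᵘ-homo-* (fromℕ m) (fromℕ n) ⟨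
  toℚᵘ (fromℕ m * fromℕ n)                 ∎)
  where open ℚᵘ.≃-Reasoning

*-denominator : ∀ q → q * fromℕ (↧ₙ q) ≡ ↥ q / 1
*-denominator q@(mkℚ i k _) = ℚ.toℚᵘ-injective (begin
  toℚᵘ (q * fromℕ (suc k))                 ≈⟨ ℚ.toℚᵘ-homo-* q (fromℕ (suc k)) ⟩
  toℚᵘ q ℚᵘ.* toℚᵘ (fromℕ (suc k))         ≈⟨ ℚᵘ.*-congˡ {toℚᵘ q} (toℚᵘ-/ (+ suc k) 0) ⟩
  ℚᵘ.mkℚᵘ i k ℚᵘ.* ℚᵘ.mkℚᵘ (+ suc k) 0     ≈⟨ ℚᵘ.*≡* (trans (ℤ.*-identityʳ _) (cong (λ n → i ℤ.* + n) (sym (ℕ.*-identityʳ (suc k))))) ⟩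
  ℚᵘ.mkℚᵘ i 0                              ≈⟨ toℚᵘ-/ i 0 ⟨
  toℚᵘ (i / 1)                             ∎)
  where open ℚᵘ.≃-Reasoning

fromℕ-nonNeg : ∀ n → NonNegative (fromℕ n)
fromℕ-nonNeg n = ℚ.normalize-nonNeg n 1

0≤fromℕ : ∀ n → 0ℚ ≤ fromℕ n
0≤fromℕ n = ℚ.nonNegative⁻¹ (fromℕ n) {{fromℕ-nonNeg n}}

fromℕ-pos : ∀ n .{{_ : NonZero n}} → Positive (fromℕ n)
fromℕ-pos n = ℚ.normalize-pos n 1

p≤p+q : ∀ p {q} → 0ℚ ≤ q → p ≤ p + q
p≤p+q p {q} 0≤q = subst (_≤ p + q) (ℚ.+-identityʳ p) (ℚ.+-monoʳ-≤ p 0≤q)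

fromℕ-mono-≤ : ∀ {m n} → m ℕ.≤ n → fromℕ m ≤ fromℕ n
fromℕ-mono-≤ {m} {n} m≤n = subst (fromℕ m ≤_)
  (trans (sym (fromℕ-+ m (n ℕ.∸ m))) (cong fromℕ (ℕ.m+[n∸m]≡n m≤n)))
  (p≤p+q (fromℕ m) (0≤fromℕ (n ℕ.∸ m)))

fromℕ-cancel-≤ : ∀ {m n} → fromℕ m ≤ fromℕ n → m ℕ.≤ n
fromℕ-cancel-≤ {m} {n} h with m ℕ.≤? n
... | yes m≤n = m≤n
... | no  m≰n = ⊥-elim (ℚ.<-irrefl refl (ℚ.<-≤-trans n<1+n (ℚ.≤-trans (fromℕ-mono-≤ (ℕ.≰⇒> m≰n)) h)))
  where
  n<1+n : fromℕ n < fromℕ (suc n)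
  n<1+n = subst₂ _<_ (ℚ.+-identityˡ (fromℕ n)) (sym (fromℕ-+ 1 n))
            (ℚ.+-monoˡ-< (fromℕ n) (ℚ.positive⁻¹ 1ℚ))

fromℕ-suc : ∀ n → fromℕ (suc n) ≡ 1ℚ + fromℕ n
fromℕ-suc = fromℕ-+ 1

-- The shift by one makes every denominator nonzero without a side condition.
recip : ℕ → ℚ
recip k = + 1 / suc k

recip-* : ∀ k → recip k * fromℕ (suc k) ≡ 1ℚ
recip-* k = ℚ.toℚᵘ-injective (begin
  toℚᵘ (recip k * fromℕ (suc k))               ≈⟨ ℚ.toℚᵘ-homo-* (recip k) (fromℕ (suc k)) ⟩
  toℚᵘ (recip k) ℚᵘ.* toℚᵘ (fromℕ (suc k))     ≈⟨ ℚᵘ.*-cong (toℚᵘ-/ (+ 1) k) (toℚᵘ-/ (+ suc k) 0) ⟩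
  ℚᵘ.mkℚᵘ (+ 1) k ℚᵘ.* ℚᵘ.mkℚᵘ (+ suc k) 0     ≈⟨ ℚᵘ.*≡* (cong +_ (ℕ.*-assoc 1 (suc k) 1)) ⟩
  toℚᵘ 1ℚ                                      ∎)
  where open ℚᵘ.≃-Reasoning

recip-pos : ∀ k → Positive (recip k)
recip-pos k = ℚ.normalize-pos 1 (suc k)

recip≤1 : ∀ k → recip k ≤ 1ℚ
recip≤1 k = subst₂ _≤_ (ℚ.*-identityʳ (recip k)) (recip-* k)
  (ℚ.*-monoˡ-≤-nonNeg (recip k) {{ℚ.pos⇒nonNeg (recip k) {{recip-pos k}}}} (fromℕ-mono-≤ {1} {suc k} (ℕ.s≤s ℕ.z≤n)))

p≤∣p∣ : ∀ p → p ≤ ∣ p ∣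
p≤∣p∣ p with ℚ.≤-total 0ℚ p
... | inj₁ 0≤p = ℚ.≤-reflexive (sym (ℚ.0≤p⇒∣p∣≡p 0≤p))
... | inj₂ p≤0 = ℚ.≤-trans p≤0 (ℚ.0≤∣p∣ p)

infix 4 _≈[_]_

-- A record keeps x, e and y recoverable by unification, which the bare inequality `∣ x - y ∣ ≤ e`
-- would not.
record _≈[_]_ (x e y : ℚ) : Set where
  constructor within
  field
    distance : ∣ x - y ∣ ≤ e

≈-sym : ∀ {e x y} → x ≈[ e ] y → y ≈[ e ] x
≈-sym {e} {x} {y} (within h) = within (subst (_≤ e)
  (trans (sym (ℚ.∣-p∣≡∣p∣ (x - y))) (cong ∣_∣ (solve 2 (λ x y → :- (x :- y) := y :- x) refl x y))) h)

≈⇒≤ : ∀ {e x y} → x ≈[ e ] y → x ≤ y + e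
≈⇒≤ {e} {x} {y} (within h) = subst (_≤ y + e) (solve 2 (λ x y → y :+ (x :- y) := x) refl x y)
  (ℚ.+-monoʳ-≤ y (ℚ.≤-trans (p≤∣p∣ (x - y)) h))

≤⇒≈ : ∀ {e x y} → x ≤ y + e → y ≤ x + e → x ≈[ e ] y
≤⇒≈ {e} {x} {y} h k with ℚ.∣p∣≡p∨∣p∣≡-p (x - y)
... | inj₁ q = within (subst₂ _≤_ (sym q) (solve 2 (λ e y → y :+ e :- y := e) refl e y) (ℚ.+-monoˡ-≤ (- y) h))
... | inj₂ q = within (subst₂ _≤_ (trans (solve 2 (λ x y → y :- x := :- (x :- y)) refl x y) (sym q))
                 (solve 2 (λ e x → x :+ e :- x := e) refl e x) (ℚ.+-monoˡ-≤ (- x) k))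

≈-refl : ∀ {e} x → 0ℚ ≤ e → x ≈[ e ] x
≈-refl {e} x 0≤e = within (subst (_≤ e) (cong ∣_∣ (sym (ℚ.+-inverseʳ x))) 0≤e)

≈-weaken : ∀ {e d x y} → e ≤ d → x ≈[ e ] y → x ≈[ d ] y
≈-weaken e≤d (within h) = within (ℚ.≤-trans h e≤d)

≈-+ : ∀ {e d x y x′ y′} → x ≈[ e ] y → x′ ≈[ d ] y′ → x + x′ ≈[ e + d ] y + y′
≈-+ {e} {d} {x} {y} {x′} {y′} (within h) (within k) = within (begin
  ∣ (x + x′) - (y + y′) ∣     ≡⟨ cong ∣_∣ (solve 4 (λ x y x′ y′ → (x :+ x′) :- (y :+ y′) := (x :- y) :+ (x′ :- y′)) refl x y x′ y′) ⟩
  ∣ (x - y) + (x′ - y′) ∣     ≤⟨ ℚ.∣p+q∣≤∣p∣+∣q∣ (x - y) (x′ - y′) ⟩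
  ∣ x - y ∣ + ∣ x′ - y′ ∣     ≤⟨ ℚ.+-mono-≤ h k ⟩
  e + d                       ∎)
  where open ℚ.≤-Reasoning

≈-trans : ∀ {e d x y z} → x ≈[ e ] y → y ≈[ d ] z → x ≈[ e + d ] z
≈-trans {e} {d} {x} {y} {z} h k = within (subst (_≤ e + d)
  (cong ∣_∣ (solve 3 (λ x y z → (x :+ y) :- (y :+ z) := x :- z) refl x y z))
  (_≈[_]_.distance (≈-+ h k)))

≈-*ˡ : ∀ {e x y} q → x ≈[ e ] y → q * x ≈[ ∣ q ∣ * e ] q * y
≈-*ˡ {e} {x} {y} q (within h) = within (begin
  ∣ q * x - q * y ∣    ≡⟨ cong ∣_∣ (solve 3 (λ q x y → q :* x :- q :* y := q :* (x :- y)) refl q x y) ⟩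
  ∣ q * (x - y) ∣      ≡⟨ ℚ.∣p*q∣≡∣p∣*∣q∣ q (x - y) ⟩
  ∣ q ∣ * ∣ x - y ∣    ≤⟨ ℚ.*-monoˡ-≤-nonNeg ∣ q ∣ {{ℚ.∣-∣-nonNeg q}} h ⟩
  ∣ q ∣ * e            ∎)
  where open ℚ.≤-Reasoning

-- Each of x and x′ lies below `y ⊔ y′ + e`, and symmetrically. Hence relu and max aggregation do
-- not enlarge errors.
≈-⊔ : ∀ {e x y x′ y′} → x ≈[ e ] y → x′ ≈[ e ] y′ → x ⊔ x′ ≈[ e ] y ⊔ y′
≈-⊔ {e} h k = ≤⇒≈ (half h k) (half (≈-sym h) (≈-sym k))
  where
  half : ∀ {x y x′ y′} → x ≈[ e ] y → x′ ≈[ e ] y′ → x ⊔ x′ ≤ y ⊔ y′ + e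
  half {y = y} {y′ = y′} h k = ℚ.⊔-lub
    (ℚ.≤-trans (≈⇒≤ h) (ℚ.+-monoˡ-≤ e (ℚ.p≤p⊔q y y′)))
    (ℚ.≤-trans (≈⇒≤ k) (ℚ.+-monoˡ-≤ e (ℚ.p≤q⊔p y y′)))

module _ {A : Set} {e : ℚ} (0≤e : 0ℚ ≤ e) (f g : A → ℚ) (f≈g : ∀ w → f w ≈[ e ] g w) where

  ≈-sumℚ : ∀ ws → sumℚ (map f ws) ≈[ fromℕ (length ws) * e ] sumℚ (map g ws)
  ≈-sumℚ []       = ≈-refl 0ℚ (ℚ.≤-reflexive (sym (ℚ.*-zeroˡ e)))
  ≈-sumℚ (w ∷ ws) = subst (sumℚ (map f (w ∷ ws)) ≈[_] sumℚ (map g (w ∷ ws)))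
    (trans (solve 2 (λ e n → e :+ n :* e := (con 1ℚ :+ n) :* e) refl e (fromℕ (length ws)))
           (cong (_* e) (sym (fromℕ-suc (length ws)))))
    (≈-+ (f≈g w) (≈-sumℚ ws))

  ≈-max : ∀ ws → aggregate max (map f ws) ≈[ e ] aggregate max (map g ws)
  ≈-max []       = ≈-refl 0ℚ 0≤e
  ≈-max (w ∷ ws) = go ws
    where
    go : ∀ us → foldr _⊔_ (f w) (map f us) ≈[ e ] foldr _⊔_ (g w) (map g us)
    go []       = f≈g w
    go (u ∷ us) = ≈-⊔ (f≈g u) (go us)

-- Continuous piecewise linear functions

relu : ℚ → ℚ
relu x = x ⊔ 0ℚ

p<q⇒0<q-p : ∀ {p q} → p < q → 0ℚ < q - p
p<q⇒0<q-p {p} {q} h = subst (_< q - p) (ℚ.+-inverseʳ p) (ℚ.+-monoˡ-< (- p) h)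

evalFrom-< : ∀ a t a′ ps {x} → x < t → evalFrom a ((t , a′) ∷ ps) x ≡ at a x
evalFrom-< a t a′ ps {x} x<t with x <? t
... | yes _   = refl
... | no  x≮t = ⊥-elim (x≮t x<t)

evalFrom-≥ : ∀ a t a′ ps {x} → t ≤ x → evalFrom a ((t , a′) ∷ ps) x ≡ evalFrom a′ ps x
evalFrom-≥ a t a′ ps {x} t≤x with x <? t
... | yes x<t = ⊥-elim (ℚ.<-irrefl refl (ℚ.<-≤-trans x<t t≤x))
... | no  _   = refl

-- The finite content of continuity: at each threshold the piece to its left and the function to its
-- right take the same value.
data Joined : Affine → List (ℚ × Affine) → Set where
  []  : ∀ {a} → Joined a []
  _∷_ : ∀ {a t a′ ps} → evalFrom a′ ps t ≡ at a t → Joined a′ ps → Joined a ((t , a′) ∷ ps)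

-- With r = `relu (x - t)`, `x - r` is min(x, t) and `t + r` is max(x, t). Left of t the bracket
-- vanishes by the joint; from t on the first summand is `at a t` and cancels. So one threshold is
-- traded for one relu.
evalFrom-relu : ∀ a t a′ ps → evalFrom a′ ps t ≡ at a t → ∀ x →
  evalFrom a ((t , a′) ∷ ps) x ≡
  at a (x - relu (x - t)) + (evalFrom a′ ps (t + relu (x - t)) - at a t)
evalFrom-relu a t a′ ps joint x with t ℚ.≤? x
... | yes t≤x = begin
  evalFrom a ((t , a′) ∷ ps) x                               ≡⟨ evalFrom-≥ a t a′ ps t≤x ⟩
  evalFrom a′ ps x                                           ≡⟨ solve 2 (λ p q → p := q :+ (p :- q)) refl _ (at a t) ⟩
  at a t + (evalFrom a′ ps x - at a t)                       ≡⟨ cong₂ (λ y z → at a y + (evalFrom a′ ps z - at a t))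
                                                                  (solve 2 (λ x t → t := x :- (x :- t)) refl x t)
                                                                  (solve 2 (λ x t → x := t :+ (x :- t)) refl x t) ⟩
  at a (x - (x - t)) + (evalFrom a′ ps (t + (x - t)) - at a t)
    ≡⟨ cong (λ r → at a (x - r) + (evalFrom a′ ps (t + r) - at a t)) (ℚ.p≥q⇒p⊔q≡p 0≤x-t) ⟨
  at a (x - relu (x - t)) + (evalFrom a′ ps (t + relu (x - t)) - at a t) ∎
  where
  open ≡-Reasoning
  0≤x-t : 0ℚ ≤ x - t
  0≤x-t = subst (_≤ x - t) (ℚ.+-inverseʳ t) (ℚ.+-monoˡ-≤ (- t) t≤x)
... | no  t≰x = begin
  evalFrom a ((t , a′) ∷ ps) x                               ≡⟨ evalFrom-< a t a′ ps x<t ⟩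
  at a x                                                     ≡⟨ cong (at a) (solve 1 (λ x → x := x :- con 0ℚ) refl x) ⟩
  at a (x - 0ℚ)                                              ≡⟨ solve 2 (λ p q → p := p :+ (q :- q)) refl _ (at a t) ⟩
  at a (x - 0ℚ) + (at a t - at a t)                          ≡⟨ cong (λ q → at a (x - 0ℚ) + (q - at a t))
                                                                  (trans (cong (evalFrom a′ ps) (ℚ.+-identityʳ t)) joint) ⟨
  at a (x - 0ℚ) + (evalFrom a′ ps (t + 0ℚ) - at a t)
    ≡⟨ cong (λ r → at a (x - r) + (evalFrom a′ ps (t + r) - at a t)) (ℚ.p≤q⇒p⊔q≡q x-t≤0) ⟨
  at a (x - relu (x - t)) + (evalFrom a′ ps (t + relu (x - t)) - at a t) ∎
  where
  open ≡-Reasoning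
  x<t : x < t
  x<t = ℚ.≰⇒> t≰x
  x-t≤0 : x - t ≤ 0ℚ
  x-t≤0 = subst (x - t ≤_) (ℚ.+-inverseʳ t) (ℚ.+-monoˡ-≤ (- t) (ℚ.<⇒≤ x<t))

½-pos : ∀ {p} → 0ℚ < p → 0ℚ < p * ½
½-pos {p} 0<p = subst (_< p * ½) (ℚ.*-zeroˡ ½) (ℚ.*-monoˡ-<-pos ½ 0<p)

½-< : ∀ {p} → 0ℚ < p → p * ½ < p
½-< {p} 0<p = subst₂ _<_ (ℚ.+-identityʳ (p * ½))
  (solve 1 (λ p → p :* con ½ :+ p :* con ½ := p) refl p) (ℚ.+-monoʳ-< (p * ½) (½-pos 0<p))

-- t is the reflection of t - h in t - h/2, and an affine function respects
-- this relation; so its value at t is a combination of values left of t.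
continuous-at : ∀ {f} → Continuous f → ∀ a {lo t} → lo < t →
  (∀ y → lo ≤ y → y < t → f y ≡ at a y) → f t ≡ at a t
continuous-at {f} cont a@(affine s c) {lo} {t} lo<t left with f t ℚ.≟ at a t
... | yes eq = eq
... | no  neq = ⊥-elim (ℚ.<-irrefl refl (ℚ.≤-<-trans gap≤ <gap))
  where
  gap = ∣ at a t - f t ∣

  0<gap : 0ℚ < gap
  0<gap with ℚ.<-cmp 0ℚ gap
  ... | tri< h _ _ = h
  ... | tri≈ _ h _ = ⊥-elim (neq (sym (trans
        (solve 2 (λ p q → p := (p :- q) :+ q) refl (at a t) (f t))
        (trans (cong (_+ f t) (ℚ.∣p∣≡0⇒p≡0 _ (sym h))) (ℚ.+-identityˡ (f t))))))
  ... | tri> _ _ h = ⊥-elim (ℚ.<-irrefl refl (ℚ.<-≤-trans h (ℚ.0≤∣p∣ _)))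

  -- A third of the gap, because `reflected` expresses the gap by three differences, A twice and B
  -- once.
  e = gap * recip 2

  0<e : 0ℚ < e
  0<e = subst (_< e) (ℚ.*-zeroˡ (recip 2)) (ℚ.*-monoˡ-<-pos (recip 2) 0<gap)

  δ   = proj₁ (cont t e 0<e)
  0<δ = proj₁ (proj₂ (cont t e 0<e))
  -- Going left from t by less than m stays both within δ of t and in the interval where f is
  -- affine.
  m   = δ ⊓ (t - lo)

  0<m : 0ℚ < m
  0<m with ℚ.⊓-sel δ (t - lo)
  ... | inj₁ eq = subst (0ℚ <_) (sym eq) 0<δ
  ... | inj₂ eq = subst (0ℚ <_) (sym eq) (p<q⇒0<q-p lo<t)

  near : ∀ h → 0ℚ < h → h < m → (f (t - h) ≡ at a (t - h)) × ∣ f (t - h) - f t ∣ < e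
  near h 0<h h<m = left (t - h) lo≤ <t , proj₂ (proj₂ (cont t e 0<e)) (t - h) close
    where
    <t : t - h < t
    <t = subst (t - h <_) (ℚ.+-identityʳ t) (ℚ.+-monoʳ-< t (ℚ.neg-antimono-< 0<h))
    lo≤ : lo ≤ t - h
    lo≤ = subst (_≤ t - h) (solve 2 (λ t l → t :- (t :- l) := l) refl t lo)
      (ℚ.+-monoʳ-≤ t (ℚ.neg-antimono-≤ (ℚ.≤-trans (ℚ.<⇒≤ h<m) (ℚ.p⊓q≤q δ (t - lo)))))
    close : ∣ (t - h) - t ∣ < δ
    close = subst (_< δ) (begin
      h                 ≡⟨ ℚ.0≤p⇒∣p∣≡p (ℚ.<⇒≤ 0<h) ⟨
      ∣ h ∣             ≡⟨ ℚ.∣-p∣≡∣p∣ h ⟨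
      ∣ - h ∣           ≡⟨ cong ∣_∣ (solve 2 (λ t h → :- h := (t :- h) :- t) refl t h) ⟩
      ∣ (t - h) - t ∣   ∎) (ℚ.<-≤-trans h<m (ℚ.p⊓q≤p δ (t - lo)))
      where open ≡-Reasoning

  h₁ = m * ½
  h₂ = h₁ * ½
  near₁ = near h₁ (½-pos 0<m) (½-< 0<m)
  near₂ = near h₂ (½-pos (½-pos 0<m)) (ℚ.<-trans (½-< (½-pos 0<m)) (½-< 0<m))
  A = f (t - h₂) - f t
  B = f (t - h₁) - f t

  -- As h₁ is twice h₂, an affine a satisfies a(t) = 2 a(t - h₂) - a(t - h₁); `f t` is subtracted
  -- from every term.
  reflected : at a t - f t ≡ (A + A) - B
  reflected = trans
    (solve 5 (λ s c t m u →
       (s :* t :+ c) :- u :=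
       (((s :* (t :- m :* con ½ :* con ½) :+ c) :- u) :+ ((s :* (t :- m :* con ½ :* con ½) :+ c) :- u))
         :- ((s :* (t :- m :* con ½) :+ c) :- u))
       refl s c t m (f t))
    (sym (cong₂ (λ p q → ((p - f t) + (p - f t)) - (q - f t)) (proj₁ near₂) (proj₁ near₁)))

  gap≤ : gap ≤ (∣ A ∣ + ∣ A ∣) + ∣ B ∣
  gap≤ = subst (_≤ (∣ A ∣ + ∣ A ∣) + ∣ B ∣) (cong ∣_∣ (sym reflected))
    (ℚ.≤-trans (ℚ.∣p-q∣≤∣p∣+∣q∣ (A + A) B) (ℚ.+-monoˡ-≤ ∣ B ∣ (ℚ.∣p+q∣≤∣p∣+∣q∣ A A)))

  <gap : (∣ A ∣ + ∣ A ∣) + ∣ B ∣ < gap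
  <gap = subst ((∣ A ∣ + ∣ A ∣) + ∣ B ∣ <_)
    (solve 1 (λ g → (g :* con (recip 2) :+ g :* con (recip 2)) :+ g :* con (recip 2) := g) refl gap)
    (ℚ.+-mono-< (ℚ.+-mono-< (proj₂ near₂) (proj₂ near₂)) (proj₂ near₁))

-- In the recursion `lo` is the preceding threshold: from it on, f is given by the remaining pieces,
-- and between it and the next threshold f is the affine a, as `continuous-at` requires.
joined : ∀ {f} → Continuous f → ∀ {lo} a ps → Linked _<_ (lo ∷ map proj₁ ps) →
         (∀ x → lo ≤ x → f x ≡ evalFrom a ps x) → Joined a ps
joined cont a []              _            agree = []
joined cont {lo} a ((t , a′) ∷ ps) (lo<t ∷ inc) agree =
  trans (sym (agree′ t ℚ.≤-refl))
    (continuous-at cont a lo<t λ y lo≤y y<t → trans (agree y lo≤y) (evalFrom-< a t a′ ps y<t))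
  ∷ joined cont a′ ps inc agree′
  where
  agree′ : ∀ x → t ≤ x → _ ≡ evalFrom a′ ps x
  agree′ x t≤x = trans (agree x (ℚ.≤-trans (ℚ.<⇒≤ lo<t) t≤x)) (evalFrom-≥ a t a′ ps t≤x)

continuous⇒joined : ∀ {f} → Continuous f → ∀ r → r Represents f →
                    Joined (Representation.first r) (rest r)
continuous⇒joined cont (representation a [] _) rep = []
continuous⇒joined cont (representation a ps@((t , _) ∷ _) inc) rep =
  -- No threshold precedes the first piece, so any point left of t can serve as `lo`.
  joined cont {t - 1ℚ} a ps (t-1<t ∷ inc) (λ x _ → rep x)
  where
  t-1<t : t - 1ℚ < t
  t-1<t = subst (t - 1ℚ <_) (ℚ.+-identityʳ t) (ℚ.+-monoʳ-< t (ℚ.negative⁻¹ (- 1ℚ)))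

-- Functions on vertices that are values of terms

≤ᵇ-cong : ∀ {m n m′ n′} → (m ℕ.≤ n → m′ ℕ.≤ n′) → (m′ ℕ.≤ n′ → m ℕ.≤ n) → (m ℕ.≤ᵇ n) ≡ (m′ ℕ.≤ᵇ n′)
≤ᵇ-cong {m} {n} {m′} {n′} to from with m ℕ.≤ᵇ n in eq | m′ ℕ.≤ᵇ n′ in eq′
... | true  | true  = refl
... | false | false = refl
... | true  | false = ⊥-elim (subst T eq′ (ℕ.≤⇒≤ᵇ (to (ℕ.≤ᵇ⇒≤ m n (subst T (sym eq) tt)))))
... | false | true  = ⊥-elim (subst T eq (ℕ.≤⇒≤ᵇ (from (ℕ.≤ᵇ⇒≤ m′ n′ (subst T (sym eq′) tt)))))

module _ {A B : Set} (Q : B → Bool) where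

  -- With a single bound number variable, `extensions` unfolds to such a concatenation of
  -- singletons.
  length-filter-singletons : (g : A → B) (R : A → Bool) → (∀ a → Q (g a) ≡ R a) → ∀ as →
    length (filterᵇ Q (concatMap (λ a → g a ∷ []) as)) ≡ length (filterᵇ R as)
  length-filter-singletons g R Q∘g []       = refl
  length-filter-singletons g R Q∘g (a ∷ as) with Q (g a) | R a | Q∘g a
  ... | true  | _ | refl = cong suc (length-filter-singletons g R Q∘g as)
  ... | false | _ | refl = length-filter-singletons g R Q∘g as

  -- The count is made block by block. For a guarded counting term R is adjacency, so the blocks of
  -- non-neighbours contribute nothing.
  length-filter-concatMap : (R : A → Bool) (g : A → List B) (n : A → ℕ) →
    (∀ a → R a ≡ true → length (filterᵇ Q (g a)) ≡ n a) →
    (∀ a → R a ≡ false → length (filterᵇ Q (g a)) ≡ 0) → ∀ as →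
    length (filterᵇ Q (concatMap g as)) ≡ ∑ (map n (filterᵇ R as))
  length-filter-concatMap R g n kept dropped []       = refl
  length-filter-concatMap R g n kept dropped (a ∷ as) = trans
    (trans (cong length (List.filter-++ (T? ∘ Q) (g a) (concatMap g as)))
           (List.length-++ (filterᵇ Q (g a))))
    (trans (cong (length (filterᵇ Q (g a)) ℕ.+_) (length-filter-concatMap R g n kept dropped as)) head)
    where
    head : length (filterᵇ Q (g a)) ℕ.+ ∑ (map n (filterᵇ R as)) ≡
           ∑ (map n (filterᵇ R (a ∷ as)))
    head with R a in eq
    ... | true  = cong (ℕ._+ _) (kept a eq)
    ... | false = cong (ℕ._+ _) (dropped a eq)

length-filter-true : ∀ {A : Set} (as : List A) → length (filterᵇ (const true) as) ≡ length as
length-filter-true as = cong length (List.filter-all (T? ∘ const true) (universal (λ _ → tt) as))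

length-filter-false : ∀ {A : Set} (as : List A) → length (filterᵇ (const false) as) ≡ 0
length-filter-false as = cong length (List.filter-none (T? ∘ const false) (universal (λ _ ()) as))

-- Evaluates the terms that define m as the number of b below m; the range n only has to reach m.
-- The general f makes the induction go through, as each step composes it with `suc`.
length-filter-applyUpTo : (R : ℕ → Bool) (f : ℕ → ℕ) → ∀ {m n} → m ℕ.≤ n →
  (∀ b → R (f b) ≡ (suc b ℕ.≤ᵇ m)) → length (filterᵇ R (applyUpTo f n)) ≡ m
length-filter-applyUpTo R f {n = zero}  z≤n       R∘f = refl
length-filter-applyUpTo R f {n = suc n} z≤n       R∘f with R (f 0) | R∘f 0
... | _ | refl = length-filter-applyUpTo R (f ∘ suc) {n = n} z≤n (R∘f ∘ suc)
length-filter-applyUpTo R f {n = suc n} (s≤s m≤n) R∘f with R (f 0) | R∘f 0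
... | _ | refl = cong suc (length-filter-applyUpTo R (f ∘ suc) m≤n (R∘f ∘ suc))

-- A function comes with one term for each choice i of the variable denoting its
-- first vertex, so that counting over other i can be nested with two variables.
data Scope : Set where
  closed unary binary : Scope

Env : Scope → LGraph p → Set
Env closed G = ⊤
Env unary  G = V G
Env binary G = V G × V G

env : ∀ s → VertexVar → {G : LGraph p} → Assignment G → Env s G
env closed i α = tt
env unary  i α = vertexAt α i
env binary i α = vertexAt α i , vertexAt α (other i)

InScope : Scope → VertexVar → Var → Set
InScope closed i z = ⊥
InScope unary  i z = z ≡ vertex i
InScope binary i z = z ≡ vertex i ⊎ z ≡ vertex (other i)

record Def {p} (s : Scope) (f : (G : LGraph p) → Env s G → ℕ) : Set where
  field
    term : VertexVar → Term p
    free : ∀ i z → FreeT z (term i) → InScope s i z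
    sem  : ∀ i {G} (α : Assignment G) → ⟦ term i ⟧ᵗ α ≡ f G (env s i α)

open Def

env-number : ∀ s i {G : LGraph p} (α : Assignment G) y b → env s i (α [ y ↦ⁿ b ]) ≡ env s i α
env-number closed i α y b = refl
env-number unary  i α y b = refl
env-number binary i α y b = refl

env-other : ∀ i {G : LGraph p} (α : Assignment G) w →
            env binary i (α [ other i ↦ᵛ w ]) ≡ (vertexAt α i , w)
env-other x₁ α w = refl
env-other x₂ α w = refl

numberAt-↦ᵛ : ∀ i {G : LGraph p} (α : Assignment G) w y → numberAt (α [ i ↦ᵛ w ]) y ≡ numberAt α y
numberAt-↦ᵛ x₁ α w y = refl
numberAt-↦ᵛ x₂ α w y = refl

module _ {s : Scope} {f : (G : LGraph p) → Env s G → ℕ} (F : Def s f) where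

  sem-number : ∀ i {G} (α : Assignment G) y b → ⟦ term F i ⟧ᵗ (α [ y ↦ⁿ b ]) ≡ f G (env s i α)
  sem-number i {G} α y b = trans (sem F i (α [ y ↦ⁿ b ])) (cong (f G) (env-number s i α y b))

sem-other : {f : (G : LGraph p) → Env binary G → ℕ} (F : Def binary f) →
  ∀ i {G} (α : Assignment G) w → ⟦ term F i ⟧ᵗ (α [ other i ↦ᵛ w ]) ≡ f G (vertexAt α i , w)
sem-other {f = f} F i {G} α w = trans (sem F i (α [ other i ↦ᵛ w ])) (cong (f G) (env-other i α w))

sem-#ⁿ : ∀ y (θ : Term p) φ {G} (α : Assignment G) (R : ℕ → Bool) →
  (∀ b → ⟦ φ ⟧ᶠ (α [ y ↦ⁿ b ]) ≡ R b) →
  ⟦ #ⁿ ((y , θ) ∷ []) φ ⟧ᵗ α ≡ length (filterᵇ R (upTo (⟦ θ ⟧ᵗ α)))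
sem-#ⁿ y θ φ α R φ≡R =
  length-filter-singletons ⟦ φ ⟧ᶠ (λ b → α [ y ↦ⁿ b ]) R φ≡R (upTo (⟦ θ ⟧ᵗ α))

-- A guarded count of pairs (w, b) is a sum over the neighbours w of counts of b, which is how
-- neighbourhood aggregation enters the logic.
sem-#ᵍ : ∀ i y (θ : Term p) φ {G} (α : Assignment G) (R : V G → ℕ → Bool) →
  (∀ w b → ⟦ φ ⟧ᶠ (α [ other i ↦ᵛ w ] [ y ↦ⁿ b ]) ≡ R w b) →
  ⟦ #ᵍ i ((y , θ) ∷ []) toOther φ ⟧ᵗ α ≡
  ∑ (map (λ w → length (filterᵇ (R w) (upTo (⟦ θ ⟧ᵗ (α [ other i ↦ᵛ w ])))))
                (neighbours G (vertexAt α i)))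
sem-#ᵍ i y θ φ {G} α R φ≡R = length-filter-concatMap Q (adj G (vertexAt α i)) extend count
  (λ w is-adj → length-filter-singletons Q (β w) (R w)
    (λ b → cong₂ _∧_ (trans (guard w) is-adj) (φ≡R w b)) (range w))
  (λ w not-adj → trans
    (length-filter-singletons Q (β w) (const false)
      (λ b → cong (_∧ ⟦ φ ⟧ᶠ (β w b)) (trans (guard w) not-adj)) (range w))
    (length-filter-false (range w)))
  (allFin (order G))
  where
  Q : Assignment G → Bool
  Q γ = ⟦ i , toOther ⟧ᵍ γ ∧ ⟦ φ ⟧ᶠ γ
  range : V G → List ℕ
  range w = upTo (⟦ θ ⟧ᵗ (α [ other i ↦ᵛ w ]))
  β : V G → ℕ → Assignment G
  β w b = α [ other i ↦ᵛ w ] [ y ↦ⁿ b ]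
  extend : V G → List (Assignment G)
  extend w = concatMap (λ b → β w b ∷ []) (range w)
  count : V G → ℕ
  count w = length (filterᵇ (R w) (range w))
  guard : ∀ w → adj G (vertexAt (α [ other i ↦ᵛ w ]) i) (vertexAt (α [ other i ↦ᵛ w ]) (other i)) ≡
                adj G (vertexAt α i) w
  guard w = cong (λ e → adj G (proj₁ e) (proj₂ e)) (env-other i α w)

-- Closure properties of definable functions

def-const : ∀ {s} n → Def {p} s (λ _ _ → n)
def-const zero    .term _ = zero
def-const (suc n) .term i = one ⊕ def-const {s = closed} n .term i
def-const (suc n) .free i z (inj₂ h) = ⊥-elim (def-const {s = closed} n .free i z h)
def-const zero    .sem i α = refl
def-const (suc n) .sem i α = cong suc (def-const {s = closed} n .sem i α)

def-order : Def {p} closed (λ G _ → order G)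
def-order .term i = ord
def-order .free i z ()
def-order .sem i α = refl

def-label : ∀ k → Def {p} unary (λ G v → if label G v k then 1 else 0)
-- The number variable takes only the value 0, so the count is the truth value of the label.
def-label k .term i = #ⁿ ((0 , one) ∷ []) (P k i)
def-label k .free i z (inj₂ (_ , h)) = h
def-label k .sem i {G} α = trans
  (sem-#ⁿ 0 one (P k i) α (λ _ → label G (vertexAt α i) k) (λ _ → refl)) value
  where
  value : length (filterᵇ (λ _ → label G (vertexAt α i) k) (0 ∷ [])) ≡ (if label G (vertexAt α i) k then 1 else 0)
  value with label G (vertexAt α i) k
  ... | true  = refl
  ... | false = refl

def-closed : ∀ {s} {f : LGraph p → ℕ} → Def closed (λ G _ → f G) → Def s (λ G _ → f G)
def-closed F .term = term F
def-closed F .free i z h = ⊥-elim (free F i z h)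
def-closed F .sem = sem F

module _ {f : (G : LGraph p) → V G → ℕ} (F : Def unary f) where

  def-first : Def binary (λ G e → f G (proj₁ e))
  def-first .term     = term F
  def-first .free i z = inj₁ ∘ free F i z
  def-first .sem      = sem F

  def-second : Def binary (λ G e → f G (proj₂ e))
  def-second .term i   = term F (other i)
  def-second .free i z = inj₂ ∘ free F (other i) z
  def-second .sem i    = sem F (other i)

module _ {s : Scope} {f g : (G : LGraph p) → Env s G → ℕ} (F : Def s f) (H : Def s g) where

  def-+ : Def s (λ G e → f G e ℕ.+ g G e)
  def-+ .term i   = term F i ⊕ term H i
  def-+ .free i z = [ free F i z , free H i z ]′
  def-+ .sem i α  = cong₂ ℕ._+_ (sem F i α) (sem H i α)

  def-* : Def s (λ G e → f G e ℕ.* g G e)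
  def-* .term i   = term F i ⊗ term H i
  def-* .free i z = [ free F i z , free H i z ]′
  def-* .sem i α  = cong₂ ℕ._*_ (sem F i α) (sem H i α)

  def-∸ : Def s (λ G e → f G e ℕ.∸ g G e)
  -- Counts the b with b + 1 + n ≤ m, that is b < m ∸ n; m is a large enough range.
  def-∸ .term i = #ⁿ ((0 , term F i) ∷ []) (((one ⊕ var 0) ⊕ term H i) ≼ term F i)
  def-∸ .free i z (inj₁ h)                            = free F i z h
  def-∸ .free i z (inj₂ (≢0 , inj₁ (inj₁ (inj₂ ≡0)))) = ⊥-elim (≢0 ≡0)
  def-∸ .free i z (inj₂ (_ , inj₁ (inj₂ h)))          = free H i z h
  def-∸ .free i z (inj₂ (_ , inj₂ h))                 = free F i z h
  def-∸ .sem i {G} α = trans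
    (sem-#ⁿ 0 (term F i) (((one ⊕ var 0) ⊕ term H i) ≼ term F i) α (λ b → suc b ℕ.+ n ℕ.≤ᵇ m)
      (λ b → cong₂ (λ x y → suc b ℕ.+ x ℕ.≤ᵇ y) (sem-number H i α 0 b) (sem-number F i α 0 b)))
    (length-filter-applyUpTo (λ b → suc b ℕ.+ n ℕ.≤ᵇ m) id
      (subst (m ℕ.∸ n ℕ.≤_) (sym (sem F i α)) (ℕ.m∸n≤m m n))
      (λ b → ≤ᵇ-cong {suc b ℕ.+ n} {m} {suc b} {m ℕ.∸ n} (ℕ.m+n≤o⇒m≤o∸n (suc b)) (λ h → ℕ.m≤o∸n⇒m+n≤o (suc b) (n≤m b h) h)))
    where
    m = f G (env s i α)
    n = g G (env s i α)
    -- Truncation has to be excluded before n can be moved back across the inequality; a positive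
    -- difference does so.
    n≤m : ∀ b → suc b ℕ.≤ m ℕ.∸ n → n ℕ.≤ m
    n≤m b h = ℕ.<⇒≤ (ℕ.m∸n≢0⇒n<m λ eq → ℕ.n≮0 (subst (suc b ℕ.≤_) eq h))

  def-/ : Def s (λ G e → f G e ℕ./ suc (g G e))
  -- Counts the b with (b + 1)(n + 1) ≤ m, that is the b below the integer quotient of m by n + 1.
  def-/ .term i = #ⁿ ((0 , term F i) ∷ []) (((one ⊕ var 0) ⊗ (one ⊕ term H i)) ≼ term F i)
  def-/ .free i z (inj₁ h)                            = free F i z h
  def-/ .free i z (inj₂ (≢0 , inj₁ (inj₁ (inj₂ ≡0)))) = ⊥-elim (≢0 ≡0)
  def-/ .free i z (inj₂ (_ , inj₁ (inj₂ (inj₂ h))))   = free H i z h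
  def-/ .free i z (inj₂ (_ , inj₂ h))                 = free F i z h
  def-/ .sem i {G} α = trans
    (sem-#ⁿ 0 (term F i) (((one ⊕ var 0) ⊗ (one ⊕ term H i)) ≼ term F i) α (λ b → suc b ℕ.* suc n ℕ.≤ᵇ m)
      (λ b → cong₂ (λ x y → suc b ℕ.* suc x ℕ.≤ᵇ y) (sem-number H i α 0 b) (sem-number F i α 0 b)))
    (length-filter-applyUpTo (λ b → suc b ℕ.* suc n ℕ.≤ᵇ m) id
      (subst (m ℕ./ suc n ℕ.≤_) (sym (sem F i α)) (ℕ.m/n≤m m (suc n)))
      (λ b → ≤ᵇ-cong {suc b ℕ.* suc n} {m} {suc b} {m ℕ./ suc n}
        (λ h → subst (ℕ._≤ m ℕ./ suc n) (ℕ.m*n/n≡m (suc b) (suc n)) (ℕ./-monoˡ-≤ (suc n) h))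
        (λ h → ℕ.≤-trans (ℕ.*-monoˡ-≤ (suc n) h) (ℕ.m/n*n≤m m (suc n)))))
    where
    m = f G (env s i α)
    n = g G (env s i α)

module _ {f : (G : LGraph p) → V G × V G → ℕ} (F : Def binary f) where

  private
    free-sum : ∀ i {z} → z ≢ vertex (other i) → InScope binary i z → z ≡ vertex i
    free-sum i ≢other (inj₁ h) = h
    free-sum i ≢other (inj₂ h) = ⊥-elim (≢other h)

  def-sum : Def unary (λ G v → ∑ (map (λ w → f G (v , w)) (neighbours G v)))
  -- The body is always true, so a neighbour w is counted once for each number below f(v, w).
  def-sum .term i = #ᵍ i ((0 , term F i) ∷ []) toOther (zero ≼ zero)
  def-sum .free i z (≢other , inj₁ h)                       = free-sum i ≢other (free F i z h)
  def-sum .free i z (≢other , inj₂ (_ , inj₁ h))            = h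
  def-sum .free i z (≢other , inj₂ (_ , inj₂ (inj₁ ≡other))) = ⊥-elim (≢other ≡other)
  def-sum .free i z (≢other , inj₂ (_ , inj₂ (inj₂ (inj₁ ()))))
  def-sum .free i z (≢other , inj₂ (_ , inj₂ (inj₂ (inj₂ ()))))
  def-sum .sem i {G} α = trans
    (sem-#ᵍ i 0 (term F i) (zero ≼ zero) α (λ _ _ → true) (λ _ _ → refl))
    (cong ∑ (List.map-cong
      (λ w → trans (length-filter-true (upTo (⟦ term F i ⟧ᵗ (α [ other i ↦ᵛ w ]))))
                   (trans (List.length-upTo (⟦ term F i ⟧ᵗ (α [ other i ↦ᵛ w ]))) (sem-other F i α w)))
      (neighbours G (vertexAt α i))))

maximum : List ℕ → ℕ
maximum = foldr ℕ._⊔_ 0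

-- Makes the sum, which is already definable, a sufficient range for the count that defines a
-- maximum.
maximum≤sum : ∀ ns → maximum ns ℕ.≤ ∑ ns
maximum≤sum []       = z≤n
maximum≤sum (n ∷ ns) = ℕ.≤-trans (ℕ.⊔-mono-≤ (ℕ.≤-refl {n}) (maximum≤sum ns)) (ℕ.m⊔n≤m+n n (∑ ns))

-- The list `0 ∷ []` is the range of a dummy number variable, so the sum counts the w with m w > b;
-- one exists exactly when b is below the maximum.
some-above : ∀ {A : Set} (m : A → ℕ) b ws →
  (1 ℕ.≤ᵇ ∑ (map (λ w → length (filterᵇ (const (not (m w ℕ.≤ᵇ b))) (0 ∷ []))) ws)) ≡
  (suc b ℕ.≤ᵇ maximum (map m ws))
some-above m b []       = refl
some-above m b (w ∷ ws) with m w ℕ.≤ᵇ b in eq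
... | false = ≤ᵇ-cong {1} {1} {suc b} (λ _ → ℕ.≤-trans b<m (ℕ.m≤m⊔n (m w) (maximum (map m ws)))) (λ _ → s≤s z≤n)
  where
  b<m : suc b ℕ.≤ m w
  b<m = ℕ.≰⇒> λ m≤b → subst T eq (ℕ.≤⇒≤ᵇ m≤b)
... | true = trans (some-above m b ws) (≤ᵇ-cong {suc b} {M} {suc b} {m w ℕ.⊔ M}
    (λ h → ℕ.≤-trans h (ℕ.m≤n⊔m (m w) M))
    (λ h → [ (λ b<m → ⊥-elim (ℕ.<⇒≱ b<m (ℕ.≤ᵇ⇒≤ (m w) b (subst T (sym eq) tt)))) , id ]′ (below h)))
  where
  M = maximum (map m ws)
  below : suc b ℕ.≤ m w ℕ.⊔ M → suc b ℕ.≤ m w ⊎ suc b ℕ.≤ M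
  below h with ℕ.⊔-sel (m w) M
  ... | inj₁ q = inj₁ (subst (suc b ℕ.≤_) q h)
  ... | inj₂ q = inj₂ (subst (suc b ℕ.≤_) q h)

module _ {f : (G : LGraph p) → V G × V G → ℕ} (F : Def binary f) where

  private
    -- Existence of a neighbour is expressed as a count of at least one. Variable 1 is a dummy;
    -- variable 0 is bound by the count in `def-maximum`.
    above : VertexVar → Formula p
    above i = one ≼ #ᵍ i ((1 , one) ∷ []) toOther (¬' (term F i ≼ var 0))

  def-maximum : Def unary (λ G v → maximum (map (λ w → f G (v , w)) (neighbours G v)))
  def-maximum .term i = #ⁿ ((0 , term (def-sum F) i) ∷ []) (above i)
  def-maximum .free i z (inj₁ h) = free (def-sum F) i z h
  def-maximum .free i z (inj₂ (≢0 , inj₂ (≢other , inj₂ (_ , inj₁ h)))) = h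
  def-maximum .free i z (inj₂ (≢0 , inj₂ (≢other , inj₂ (_ , inj₂ (inj₁ h))))) = ⊥-elim (≢other h)
  def-maximum .free i z (inj₂ (≢0 , inj₂ (≢other , inj₂ (_ , inj₂ (inj₂ (inj₁ h)))))) with free F i z h
  ... | inj₁ q = q
  ... | inj₂ q = ⊥-elim (≢other q)
  def-maximum .free i z (inj₂ (≢0 , inj₂ (≢other , inj₂ (_ , inj₂ (inj₂ (inj₂ h)))))) = ⊥-elim (≢0 h)
  def-maximum .sem i {G} α = trans
    (sem-#ⁿ 0 (term (def-sum F) i) (above i) α (λ b → suc b ℕ.≤ᵇ M) λ b →
      trans (cong (1 ℕ.≤ᵇ_) (sem-#ᵍ i 1 one (¬' (term F i ≼ var 0)) (α [ 0 ↦ⁿ b ])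
               (λ w _ → not (m w ℕ.≤ᵇ b)) λ w c → cong₂ (λ x y → not (x ℕ.≤ᵇ y))
                 (trans (sem-number F i (α [ 0 ↦ⁿ b ] [ other i ↦ᵛ w ]) 1 c)
                        (cong (f G) (env-other i (α [ 0 ↦ⁿ b ]) w)))
                 (numberAt-↦ᵛ (other i) (α [ 0 ↦ⁿ b ]) w 0)))
            (some-above m b ws))
    (length-filter-applyUpTo (λ b → suc b ℕ.≤ᵇ M) id
      (subst (M ℕ.≤_) (sym (sem (def-sum F) i α)) (maximum≤sum (map m ws))) (λ _ → refl))
    where
    ws = neighbours G (vertexAt α i)
    m : V G → ℕ
    m w = f G (vertexAt α i , w)
    M = maximum (map m ws)

-- Exactly representable rational functions

fromℕ-⊔ : ∀ m n → fromℕ (m ℕ.⊔ n) ≡ fromℕ m ⊔ fromℕ n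
fromℕ-⊔ m n with ℕ.≤-total m n
... | inj₁ m≤n = trans (cong fromℕ (ℕ.m≤n⇒m⊔n≡n m≤n)) (sym (ℚ.p≤q⇒p⊔q≡q (fromℕ-mono-≤ m≤n)))
... | inj₂ n≤m = trans (cong fromℕ (ℕ.m≥n⇒m⊔n≡m n≤m)) (sym (ℚ.p≥q⇒p⊔q≡p (fromℕ-mono-≤ n≤m)))

fromℕ-∸ : ∀ {m n} → n ℕ.≤ m → fromℕ (m ℕ.∸ n) ≡ fromℕ m - fromℕ n
fromℕ-∸ {m} {n} n≤m = trans
  (solve 2 (λ x y → x := (y :+ x) :- y) refl (fromℕ (m ℕ.∸ n)) (fromℕ n))
  (cong (_- fromℕ n) (trans (sym (fromℕ-+ n (m ℕ.∸ n))) (cong fromℕ (ℕ.m+[n∸m]≡n n≤m))))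

relu-fromℕ : ∀ m n → relu (fromℕ m - fromℕ n) ≡ fromℕ (m ℕ.∸ n)
relu-fromℕ m n with ℕ.≤-total m n
... | inj₁ m≤n = trans
  (ℚ.p≤q⇒p⊔q≡q (subst (fromℕ m - fromℕ n ≤_) (ℚ.+-inverseʳ (fromℕ n)) (ℚ.+-monoˡ-≤ (- fromℕ n) (fromℕ-mono-≤ m≤n))))
  (cong fromℕ (sym (ℕ.m≤n⇒m∸n≡0 m≤n)))
... | inj₂ n≤m = trans
  (cong relu (sym (fromℕ-∸ n≤m))) (ℚ.p≥q⇒p⊔q≡p (0≤fromℕ (m ℕ.∸ n)))

fromℕ-*+* : ∀ a b c d → fromℕ (a ℕ.* b ℕ.+ c ℕ.* d) ≡ fromℕ a * fromℕ b + fromℕ c * fromℕ d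
fromℕ-*+* a b c d = trans (fromℕ-+ (a ℕ.* b) (c ℕ.* d)) (cong₂ _+_ (fromℕ-* a b) (fromℕ-* c d))

all≤∑ : ∀ {A : Set} (f : A → ℕ) as → All (λ a → f a ℕ.≤ ∑ (map f as)) as
all≤∑ f []       = []
all≤∑ f (a ∷ as) = ℕ.m≤m+n (f a) _ ∷ All.map (λ h → ℕ.≤-trans h (ℕ.m≤n+m _ (f a))) (all≤∑ f as)

module _ {A : Set} (f : A → ℚ) (a b : A → ℕ) (c : ℕ)
         (f*c : ∀ w → f w * fromℕ c ≡ fromℕ (a w) - fromℕ (b w)) where

  sumℚ-* : ∀ ws → sumℚ (map f ws) * fromℕ c ≡ fromℕ (∑ (map a ws)) - fromℕ (∑ (map b ws))
  sumℚ-* []       = ℚ.*-zeroˡ (fromℕ c)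
  sumℚ-* (w ∷ ws) = begin
    (f w + F) * fromℕ c                                       ≡⟨ ℚ.*-distribʳ-+ (fromℕ c) (f w) F ⟩
    f w * fromℕ c + F * fromℕ c                               ≡⟨ cong₂ _+_ (f*c w) (sumℚ-* ws) ⟩
    (fromℕ (a w) - fromℕ (b w)) + (fromℕ A′ - fromℕ B′)       ≡⟨ solve 4 (λ a b A B → (a :- b) :+ (A :- B) := (a :+ A) :- (b :+ B)) refl
                                                                   (fromℕ (a w)) (fromℕ (b w)) (fromℕ A′) (fromℕ B′) ⟩
    (fromℕ (a w) + fromℕ A′) - (fromℕ (b w) + fromℕ B′)       ≡⟨ cong₂ _-_ (fromℕ-+ (a w) A′) (fromℕ-+ (b w) B′) ⟨
    fromℕ (a w ℕ.+ A′) - fromℕ (b w ℕ.+ B′)                   ∎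
    where
    open ≡-Reasoning
    F  = sumℚ (map f ws)
    A′ = ∑ (map a ws)
    B′ = ∑ (map b ws)

  -- Adding a common bound B of all b w makes the values natural numbers.
  module _ (B : ℕ) where

    shifted : A → ℕ
    shifted w = a w ℕ.+ (B ℕ.∸ b w)

    private
      shift : ℚ → ℚ
      shift x = x * fromℕ c + fromℕ B

      shift-⊔ : ∀ x y → shift (x ⊔ y) ≡ shift x ⊔ shift y
      shift-⊔ = ℚ.mono-≤-distrib-⊔ λ x≤y →
        ℚ.+-monoˡ-≤ (fromℕ B) (ℚ.*-monoʳ-≤-nonNeg (fromℕ c) {{fromℕ-nonNeg c}} x≤y)

      shift-f : ∀ {w} → b w ℕ.≤ B → shift (f w) ≡ fromℕ (shifted w)
      shift-f {w} b≤B = begin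
        f w * fromℕ c + fromℕ B                     ≡⟨ cong (_+ fromℕ B) (f*c w) ⟩
        (fromℕ (a w) - fromℕ (b w)) + fromℕ B       ≡⟨ solve 3 (λ a b B → (a :- b) :+ B := a :+ (B :- b)) refl
                                                         (fromℕ (a w)) (fromℕ (b w)) (fromℕ B) ⟩
        fromℕ (a w) + (fromℕ B - fromℕ (b w))       ≡⟨ cong (λ x → fromℕ (a w) + x) (fromℕ-∸ b≤B) ⟨
        fromℕ (a w) + fromℕ (B ℕ.∸ b w)             ≡⟨ fromℕ-+ (a w) (B ℕ.∸ b w) ⟨
        fromℕ (shifted w)                           ∎
        where open ≡-Reasoning

      shift-foldr : ∀ w us → b w ℕ.≤ B → All (λ u → b u ℕ.≤ B) us →
        shift (foldr _⊔_ (f w) (map f us)) ≡ fromℕ (maximum (map shifted (w ∷ us)))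
      shift-foldr w []       b≤B []           = trans (shift-f b≤B) (cong fromℕ (sym (ℕ.⊔-identityʳ (shifted w))))
      shift-foldr w (u ∷ us) b≤B (b′≤B ∷ all) = begin
        shift (f u ⊔ foldr _⊔_ (f w) (map f us))                ≡⟨ shift-⊔ (f u) (foldr _⊔_ (f w) (map f us)) ⟩
        shift (f u) ⊔ shift (foldr _⊔_ (f w) (map f us))        ≡⟨ cong₂ _⊔_ (shift-f b′≤B) (shift-foldr w us b≤B all) ⟩
        fromℕ (shifted u) ⊔ fromℕ (shifted w ℕ.⊔ M)             ≡⟨ fromℕ-⊔ (shifted u) (shifted w ℕ.⊔ M) ⟨
        -- The fold of max aggregation has the head w innermost, `maximum` has it outermost.
        fromℕ (shifted u ℕ.⊔ (shifted w ℕ.⊔ M))                 ≡⟨ cong fromℕ (swap (shifted u) (shifted w)) ⟩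
        fromℕ (shifted w ℕ.⊔ (shifted u ℕ.⊔ M))                 ∎
        where
        open ≡-Reasoning
        M = maximum (map shifted us)
        swap : ∀ x y → x ℕ.⊔ (y ℕ.⊔ M) ≡ y ℕ.⊔ (x ℕ.⊔ M)
        swap x y = trans (sym (ℕ.⊔-assoc x y M)) (trans (cong (ℕ._⊔ M) (ℕ.⊔-comm x y)) (ℕ.⊔-assoc y x M))

    max-*-nonempty : ∀ w us → All (λ u → b u ℕ.≤ B) (w ∷ us) →
      aggregate max (map f (w ∷ us)) * fromℕ c ≡ fromℕ (maximum (map shifted (w ∷ us))) - fromℕ B
    max-*-nonempty w us (b≤B ∷ all) = trans
      (solve 2 (λ x B → x := (x :+ B) :- B) refl (foldr _⊔_ (f w) (map f us) * fromℕ c) (fromℕ B))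
      (cong (_- fromℕ B) (shift-foldr w us b≤B all))

  -- As common bound serves the sum of all b w, since it is the value of a counting term. On the
  -- empty list all quantities are 0, in agreement with the default of max.
  max-* : ∀ ws → aggregate max (map f ws) * fromℕ c ≡
    fromℕ (maximum (map (shifted (∑ (map b ws))) ws)) - fromℕ (∑ (map b ws))
  max-* []       = ℚ.*-zeroˡ (fromℕ c)
  max-* (w ∷ ws) = max-*-nonempty (∑ (map b (w ∷ ws))) w ws (all≤∑ b (w ∷ ws))

-- F is (pos - neg) / (den + 1); den is closed, so that neighbours share a denominator.
record Exact {p} (s : Scope) (F : (G : LGraph p) → Env s G → ℚ) : Set where
  field
    pos neg : (G : LGraph p) → Env s G → ℕ
    den     : LGraph p → ℕ
    def-pos : Def s pos
    def-neg : Def s neg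
    def-den : Def closed (λ G _ → den G)
    exact   : ∀ G e → F G e * fromℕ (suc (den G)) ≡ fromℕ (pos G e) - fromℕ (neg G e)

open Exact

exact-ℕ : ∀ {s} {f : (G : LGraph p) → Env s G → ℕ} → Def s f → Exact s (λ G e → fromℕ (f G e))
exact-ℕ {f = f} F .pos = f
exact-ℕ {f = f} F .neg _ _ = 0
exact-ℕ {f = f} F .den _ = 0
exact-ℕ {f = f} F .def-pos = F
exact-ℕ {f = f} F .def-neg = def-const 0
exact-ℕ {f = f} F .def-den = def-const 0
exact-ℕ {f = f} F .exact G e = solve 1 (λ x → x :* con 1ℚ := x :- con 0ℚ) refl (fromℕ (f G e))

exact-const : ∀ {s} q → Exact {p} s (λ _ _ → q)
exact-const q .den _ = ℚ.ℚ.denominator-1 q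
exact-const q .def-den = def-const (ℚ.ℚ.denominator-1 q)
exact-const (mkℚ (+ n)      _ _) .pos _ _ = n
exact-const (mkℚ (-[1+ n ]) _ _) .pos _ _ = 0
exact-const (mkℚ (+ n)      _ _) .neg _ _ = 0
exact-const (mkℚ (-[1+ n ]) _ _) .neg _ _ = suc n
exact-const (mkℚ (+ n)      _ _) .def-pos = def-const n
exact-const (mkℚ (-[1+ n ]) _ _) .def-pos = def-const 0
exact-const (mkℚ (+ n)      _ _) .def-neg = def-const 0
exact-const (mkℚ (-[1+ n ]) _ _) .def-neg = def-const (suc n)
exact-const q@(mkℚ (+ n)      _ _) .exact G e = trans (*-denominator q) (sym (ℚ.+-identityʳ (fromℕ n)))
exact-const q@(mkℚ (-[1+ n ]) _ _) .exact G e = trans (*-denominator q) (sym (ℚ.+-identityˡ (- fromℕ (suc n))))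

module _ {s : Scope} {F : (G : LGraph p) → Env s G → ℚ} (X : Exact s F) where

  exact-cong : ∀ {F′} → (∀ G e → F G e ≡ F′ G e) → Exact s F′
  exact-cong F≗F′ .pos = pos X
  exact-cong F≗F′ .neg = neg X
  exact-cong F≗F′ .den = den X
  exact-cong F≗F′ .def-pos = def-pos X
  exact-cong F≗F′ .def-neg = def-neg X
  exact-cong F≗F′ .def-den = def-den X
  exact-cong F≗F′ .exact G e = trans (cong (_* fromℕ (suc (den X G))) (sym (F≗F′ G e))) (exact X G e)

  -- The denominator is positive, so the positive part is taken in the numerator, where it is
  -- truncated subtraction.
  exact-relu : Exact s (λ G e → relu (F G e))
  exact-relu .pos G e = pos X G e ℕ.∸ neg X G e
  exact-relu .neg _ _ = 0
  exact-relu .den = den X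
  exact-relu .def-pos = def-∸ (def-pos X) (def-neg X)
  exact-relu .def-neg = def-const 0
  exact-relu .def-den = def-den X
  exact-relu .exact G e = begin
    (F G e ⊔ 0ℚ) * c                         ≡⟨ ℚ.*-distribʳ-⊔-nonNeg c {{fromℕ-nonNeg (suc (den X G))}} (F G e) 0ℚ ⟩
    F G e * c ⊔ 0ℚ * c                       ≡⟨ cong₂ _⊔_ (exact X G e) (ℚ.*-zeroˡ c) ⟩
    relu (fromℕ (pos X G e) - fromℕ (neg X G e))  ≡⟨ relu-fromℕ (pos X G e) (neg X G e) ⟩
    fromℕ (pos X G e ℕ.∸ neg X G e)          ≡⟨ ℚ.+-identityʳ _ ⟨
    fromℕ (pos X G e ℕ.∸ neg X G e) - 0ℚ     ∎
    where
    open ≡-Reasoning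
    c = fromℕ (suc (den X G))

module _ {s : Scope} {F H : (G : LGraph p) → Env s G → ℚ} (X : Exact s F) (Y : Exact s H) where

  private
    -- Chosen so that `suc (den-* G)` is by computation the product of the two denominators.
    den-* : LGraph p → ℕ
    den-* G = den Y G ℕ.+ den X G ℕ.* suc (den Y G)

    def-den-* : Def closed (λ G _ → den-* G)
    def-den-* = def-+ (def-den Y) (def-* (def-den X) (def-+ (def-const 1) (def-den Y)))

  exact-+ : Exact s (λ G e → F G e + H G e)
  exact-+ .pos G e = pos X G e ℕ.* suc (den Y G) ℕ.+ pos Y G e ℕ.* suc (den X G)
  exact-+ .neg G e = neg X G e ℕ.* suc (den Y G) ℕ.+ neg Y G e ℕ.* suc (den X G)
  exact-+ .den = den-*
  exact-+ .def-pos = def-+ (def-* (def-pos X) (def-+ (def-const 1) (def-closed (def-den Y))))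
                           (def-* (def-pos Y) (def-+ (def-const 1) (def-closed (def-den X))))
  exact-+ .def-neg = def-+ (def-* (def-neg X) (def-+ (def-const 1) (def-closed (def-den Y))))
                           (def-* (def-neg Y) (def-+ (def-const 1) (def-closed (def-den X))))
  exact-+ .def-den = def-den-*
  exact-+ .exact G e = begin
    (F G e + H G e) * fromℕ (suc dX ℕ.* suc dY)         ≡⟨ cong ((F G e + H G e) *_) (fromℕ-* (suc dX) (suc dY)) ⟩
    (F G e + H G e) * (c * d)                           ≡⟨ solve 4 (λ f h c d → (f :+ h) :* (c :* d) := (f :* c) :* d :+ (h :* d) :* c) refl (F G e) (H G e) c d ⟩
    (F G e * c) * d + (H G e * d) * c                   ≡⟨ cong₂ (λ x y → x * d + y * c) (exact X G e) (exact Y G e) ⟩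
    (fromℕ a - fromℕ b) * d + (fromℕ a′ - fromℕ b′) * c ≡⟨ solve 6 (λ a b a′ b′ c d → (a :- b) :* d :+ (a′ :- b′) :* c := (a :* d :+ a′ :* c) :- (b :* d :+ b′ :* c)) refl
                                                             (fromℕ a) (fromℕ b) (fromℕ a′) (fromℕ b′) c d ⟩
    (fromℕ a * d + fromℕ a′ * c) - (fromℕ b * d + fromℕ b′ * c)
      ≡⟨ cong₂ _-_ (fromℕ-*+* a (suc dY) a′ (suc dX)) (fromℕ-*+* b (suc dY) b′ (suc dX)) ⟨
    fromℕ (a ℕ.* suc dY ℕ.+ a′ ℕ.* suc dX) - fromℕ (b ℕ.* suc dY ℕ.+ b′ ℕ.* suc dX) ∎
    where
    open ≡-Reasoning
    dX = den X G
    dY = den Y G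
    c = fromℕ (suc dX)
    d = fromℕ (suc dY)
    a = pos X G e
    b = neg X G e
    a′ = pos Y G e
    b′ = neg Y G e

  exact-* : Exact s (λ G e → F G e * H G e)
  exact-* .pos G e = pos X G e ℕ.* pos Y G e ℕ.+ neg X G e ℕ.* neg Y G e
  exact-* .neg G e = pos X G e ℕ.* neg Y G e ℕ.+ neg X G e ℕ.* pos Y G e
  exact-* .den = den-*
  exact-* .def-pos = def-+ (def-* (def-pos X) (def-pos Y)) (def-* (def-neg X) (def-neg Y))
  exact-* .def-neg = def-+ (def-* (def-pos X) (def-neg Y)) (def-* (def-neg X) (def-pos Y))
  exact-* .def-den = def-den-*
  exact-* .exact G e = begin
    (F G e * H G e) * fromℕ (suc dX ℕ.* suc dY)         ≡⟨ cong ((F G e * H G e) *_) (fromℕ-* (suc dX) (suc dY)) ⟩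
    (F G e * H G e) * (c * d)                           ≡⟨ solve 4 (λ f h c d → (f :* h) :* (c :* d) := (f :* c) :* (h :* d)) refl (F G e) (H G e) c d ⟩
    (F G e * c) * (H G e * d)                           ≡⟨ cong₂ _*_ (exact X G e) (exact Y G e) ⟩
    (fromℕ a - fromℕ b) * (fromℕ a′ - fromℕ b′)         ≡⟨ solve 4 (λ a b a′ b′ → (a :- b) :* (a′ :- b′) := (a :* a′ :+ b :* b′) :- (a :* b′ :+ b :* a′)) refl
                                                             (fromℕ a) (fromℕ b) (fromℕ a′) (fromℕ b′) ⟩
    (fromℕ a * fromℕ a′ + fromℕ b * fromℕ b′) - (fromℕ a * fromℕ b′ + fromℕ b * fromℕ a′)
      ≡⟨ cong₂ _-_ (fromℕ-*+* a a′ b b′) (fromℕ-*+* a b′ b a′) ⟨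
    fromℕ (a ℕ.* a′ ℕ.+ b ℕ.* b′) - fromℕ (a ℕ.* b′ ℕ.+ b ℕ.* a′) ∎
    where
    open ≡-Reasoning
    dX = den X G
    dY = den Y G
    c = fromℕ (suc dX)
    d = fromℕ (suc dY)
    a = pos X G e
    b = neg X G e
    a′ = pos Y G e
    b′ = neg Y G e

module _ {F : (G : LGraph p) → V G → ℚ} (X : Exact unary F) where

  exact-first : Exact binary (λ G e → F G (proj₁ e))
  exact-first .pos G e = pos X G (proj₁ e)
  exact-first .neg G e = neg X G (proj₁ e)
  exact-first .den = den X
  exact-first .def-pos = def-first (def-pos X)
  exact-first .def-neg = def-first (def-neg X)
  exact-first .def-den = def-den X
  exact-first .exact G e = exact X G (proj₁ e)

  exact-second : Exact binary (λ G e → F G (proj₂ e))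
  exact-second .pos G e = pos X G (proj₂ e)
  exact-second .neg G e = neg X G (proj₂ e)
  exact-second .den = den X
  exact-second .def-pos = def-second (def-pos X)
  exact-second .def-neg = def-second (def-neg X)
  exact-second .def-den = def-den X
  exact-second .exact G e = exact X G (proj₂ e)

module _ {F : (G : LGraph p) → V G × V G → ℚ} (X : Exact binary F) where

  exact-sum : Exact unary (λ G v → sumℚ (map (λ w → F G (v , w)) (neighbours G v)))
  exact-sum .pos G v = ∑ (map (λ w → pos X G (v , w)) (neighbours G v))
  exact-sum .neg G v = ∑ (map (λ w → neg X G (v , w)) (neighbours G v))
  exact-sum .den = den X
  exact-sum .def-pos = def-sum (def-pos X)
  exact-sum .def-neg = def-sum (def-neg X)
  exact-sum .def-den = def-den X
  exact-sum .exact G v = sumℚ-* (λ w → F G (v , w)) (λ w → pos X G (v , w)) (λ w → neg X G (v , w))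
    (suc (den X G)) (λ w → exact X G (v , w)) (neighbours G v)

  exact-max : Exact unary (λ G v → aggregate max (map (λ w → F G (v , w)) (neighbours G v)))
  exact-max .pos G v = maximum (map (λ w → pos X G (v , w) ℕ.+
    (∑ (map (λ u → neg X G (v , u)) (neighbours G v)) ℕ.∸ neg X G (v , w))) (neighbours G v))
  exact-max .neg G v = ∑ (map (λ w → neg X G (v , w)) (neighbours G v))
  exact-max .den = den X
  -- The common bound is a sum at v alone; `def-first` makes it available under the maximum over w.
  exact-max .def-pos = def-maximum (def-+ (def-pos X) (def-∸ (def-first (def-sum (def-neg X))) (def-neg X)))
  exact-max .def-neg = def-sum (def-neg X)
  exact-max .def-den = def-den X
  exact-max .exact G v = max-* (λ w → F G (v , w)) (λ w → pos X G (v , w)) (λ w → neg X G (v , w))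
    (suc (den X G)) (λ w → exact X G (v , w)) (neighbours G v)

-- Approximable functions

*-recip-cancel : ∀ x k → (x * recip k) * fromℕ (suc k) ≡ x
*-recip-cancel x k = trans (ℚ.*-assoc x (recip k) (fromℕ (suc k)))
  (trans (cong (x *_) (recip-* k)) (ℚ.*-identityʳ x))

*-recip : ∀ m d → fromℕ (m ℕ.* suc d) * recip d ≡ fromℕ m
*-recip m d = begin
  fromℕ (m ℕ.* suc d) * recip d              ≡⟨ cong (_* recip d) (fromℕ-* m (suc d)) ⟩
  (fromℕ m * fromℕ (suc d)) * recip d        ≡⟨ solve 3 (λ m d r → (m :* d) :* r := (m :* r) :* d) refl (fromℕ m) (fromℕ (suc d)) (recip d) ⟩
  (fromℕ m * recip d) * fromℕ (suc d)        ≡⟨ *-recip-cancel (fromℕ m) d ⟩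
  fromℕ m                                    ∎
  where open ≡-Reasoning

recip-mono : ∀ {m n} d → m ℕ.≤ n → fromℕ m * recip d ≤ fromℕ n * recip d
recip-mono d m≤n = ℚ.*-monoʳ-≤-nonNeg (recip d) {{ℚ.pos⇒nonNeg (recip d) {{recip-pos d}}}} (fromℕ-mono-≤ m≤n)

floor-≤ : ∀ n d → fromℕ (n ℕ./ suc d) ≤ fromℕ n * recip d
floor-≤ n d = subst (_≤ fromℕ n * recip d) (*-recip (n ℕ./ suc d) d) (recip-mono d (ℕ.m/n*n≤m n (suc d)))

≤-floor+1 : ∀ n d → fromℕ n * recip d ≤ fromℕ (n ℕ./ suc d) + 1ℚ
≤-floor+1 n d = subst (fromℕ n * recip d ≤_)
  (trans (*-recip (suc (n ℕ./ suc d)) d) (trans (fromℕ-suc (n ℕ./ suc d)) (ℚ.+-comm 1ℚ (fromℕ (n ℕ./ suc d)))))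
  (recip-mono d (subst (ℕ._≤ suc (n ℕ./ suc d) ℕ.* suc d) (sym (ℕ.m≡m%n+[m/n]*n n (suc d)))
    (ℕ.+-monoˡ-≤ (n ℕ./ suc d ℕ.* suc d) (ℕ.m%n≤n n (suc d)))))

-- Both quotients are rounded down by at most 1, so the two errors enter the difference with
-- opposite signs and their total is at most 1, not 2.
floor-difference : ∀ m n d →
  fromℕ (m ℕ./ suc d) - fromℕ (n ℕ./ suc d) ≈[ 1ℚ ] fromℕ m * recip d - fromℕ n * recip d
floor-difference m n d = ≤⇒≈
  (subst (A - B ≤_) (sym (ℚ.+-assoc x (- y) 1ℚ)) (ℚ.+-mono-≤ (floor-≤ m d) -B≤-y+1))
  (subst (x - y ≤_) (solve 3 (λ A B c → (A :+ c) :- B := (A :- B) :+ c) refl A B 1ℚ)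
    (ℚ.+-mono-≤ (≤-floor+1 m d) (ℚ.neg-antimono-≤ (floor-≤ n d))))
  where
  A = fromℕ (m ℕ./ suc d)
  B = fromℕ (n ℕ./ suc d)
  x = fromℕ m * recip d
  y = fromℕ n * recip d
  -B≤-y+1 : - B ≤ - y + 1ℚ
  -B≤-y+1 = subst (_≤ - y + 1ℚ) (solve 2 (λ B c → :- (B :+ c) :+ c := :- B) refl B 1ℚ)
    (ℚ.+-monoˡ-≤ 1ℚ (ℚ.neg-antimono-≤ (≤-floor+1 n d)))

≈-*ʳ-cancel : ∀ {e x y} k .{{_ : Positive k}} → x * k ≈[ e * k ] y * k → x ≈[ e ] y
≈-*ʳ-cancel {e} {x} {y} k (within h) = within (ℚ.*-cancelʳ-≤-pos k (subst (_≤ e * k) (begin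
  ∣ x * k - y * k ∣    ≡⟨ cong ∣_∣ (solve 3 (λ x y k → x :* k :- y :* k := (x :- y) :* k) refl x y k) ⟩
  ∣ (x - y) * k ∣      ≡⟨ ℚ.∣p*q∣≡∣p∣*∣q∣ (x - y) k ⟩
  ∣ x - y ∣ * ∣ k ∣    ≡⟨ cong (∣ x - y ∣ *_) (ℚ.0≤p⇒∣p∣≡p (ℚ.<⇒≤ (ℚ.positive⁻¹ k))) ⟩
  ∣ x - y ∣ * k        ∎) h))
  where open ≡-Reasoning

-- Terms refer only to `size`; `1≤` says without division that the width is at least 1/size. Both
-- may depend on the graph, so that factors such as its order can be absorbed.
record Tolerance (p : ℕ) : Set where
  field
    width    : LGraph p → ℚ
    size     : LGraph p → ℕ
    def-size : Def closed (λ G _ → size G)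
    0≤width  : ∀ G → 0ℚ ≤ width G
    1≤       : ∀ G → 1ℚ ≤ width G * fromℕ (size G)

open Tolerance

-- Compensates in advance for an operation that multiplies errors by at most k + 1.
shrink : {k : LGraph p → ℕ} → Tolerance p → Def closed (λ G _ → k G) → Tolerance p
shrink {k = k} t K .width G = width t G * recip (k G)
shrink {k = k} t K .size G = size t G ℕ.* suc (k G)
shrink {k = k} t K .def-size = def-* (def-size t) (def-+ (def-const 1) K)
shrink {k = k} t K .0≤width G = subst (_≤ width t G * recip (k G)) (ℚ.*-zeroˡ (recip (k G)))
  (ℚ.*-monoʳ-≤-nonNeg (recip (k G)) {{ℚ.pos⇒nonNeg (recip (k G)) {{recip-pos (k G)}}}} (0≤width t G))
shrink {k = k} t K .1≤ G = subst (1ℚ ≤_) (begin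
  w * fromℕ s                                     ≡⟨ cong (w *_) (*-recip s (k G)) ⟨
  w * (fromℕ (s ℕ.* suc (k G)) * recip (k G))     ≡⟨ solve 3 (λ w s r → w :* (s :* r) := (w :* r) :* s) refl w (fromℕ (s ℕ.* suc (k G))) (recip (k G)) ⟩
  (w * recip (k G)) * fromℕ (s ℕ.* suc (k G))     ∎) (1≤ t G)
  where
  open ≡-Reasoning
  w = width t G
  s = size t G

shrink-width : ∀ e k → fromℕ (suc k) * (e * recip k) ≡ e
shrink-width e k = trans (ℚ.*-comm (fromℕ (suc k)) (e * recip k)) (*-recip-cancel e k)

halve : Tolerance p → Tolerance p
halve t = shrink t (def-const 1)

halve-width : ∀ (t : Tolerance p) G → width (halve t) G + width (halve t) G ≡ width t G
halve-width t G = solve 1 (λ e → e :* con (recip 1) :+ e :* con (recip 1) := e) refl (width t G)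

-- The approximant depends on the tolerance but is uniform in the graph, so a single term serves all
-- graphs.
Approximable : ∀ {p} s → ((G : LGraph p) → Env s G → ℚ) → Set
Approximable {p} s F = (t : Tolerance p) →
  Σ[ F′ ∈ ((G : LGraph p) → Env s G → ℚ) ] Exact s F′ × (∀ G e → F′ G e ≈[ width t G ] F G e)

module _ {s : Scope} {F : (G : LGraph p) → Env s G → ℚ} where

  approx-exact : Exact s F → Approximable s F
  approx-exact X t = F , X , λ G e → ≈-refl (F G e) (0≤width t G)

  approx-cong : ∀ {F′} → (∀ G e → F G e ≡ F′ G e) → Approximable s F → Approximable s F′
  approx-cong F≗F′ A t = let H , X , h = A t in
    H , X , λ G e → subst (H G e ≈[ width t G ]_) (F≗F′ G e) (h G e)

  approx-relu : Approximable s F → Approximable s (λ G e → relu (F G e))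
  approx-relu A t = let H , X , h = A t in
    (λ G e → relu (H G e)) , exact-relu X , λ G e → ≈-⊔ (h G e) (≈-refl 0ℚ (0≤width t G))

  approx-+ : ∀ {F′} → Approximable s F → Approximable s F′ → Approximable s (λ G e → F G e + F′ G e)
  approx-+ {F′} A A′ t =
    let H  , X  , h  = A (halve t)
        H′ , X′ , h′ = A′ (halve t)
    in (λ G e → H G e + H′ G e) , exact-+ X X′ ,
       λ G e → subst (H G e + H′ G e ≈[_] F G e + F′ G e) (halve-width t G) (≈-+ (h G e) (h′ G e))

  -- Rounding the quotients of the scaled numerators changes the value by at
  -- most the reciprocal of the new denominator.
  approx-exact-/ : ∀ {d} → Exact s F → Def s d → Approximable s (λ G e → F G e * recip (d G e))
  approx-exact-/ {d} X D t = H , Y , close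
    where
    -- The divisor varies with the vertices and is therefore absorbed into the rounded numerators A
    -- and B. The new denominator `suc (k G)` is `scale G` times the old one: it is closed again and
    -- at least the size of t.
    scale : LGraph p → ℕ
    scale G = suc (size t G)

    k : LGraph p → ℕ
    k G = den X G ℕ.+ size t G ℕ.* suc (den X G)

    A B : ∀ G → Env s G → ℕ
    A G e = (scale G ℕ.* pos X G e) ℕ./ suc (d G e)
    B G e = (scale G ℕ.* neg X G e) ℕ./ suc (d G e)

    H : ∀ G → Env s G → ℚ
    H G e = (fromℕ (A G e) - fromℕ (B G e)) * recip (k G)

    H*k : ∀ G e → H G e * fromℕ (suc (k G)) ≡ fromℕ (A G e) - fromℕ (B G e)
    H*k G e = *-recip-cancel (fromℕ (A G e) - fromℕ (B G e)) (k G)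

    def-scale : Def s (λ G _ → scale G)
    def-scale = def-+ (def-const 1) (def-closed (def-size t))

    Y : Exact s H
    Y .pos = A
    Y .neg = B
    Y .den = k
    Y .def-pos = def-/ (def-* def-scale (def-pos X)) D
    Y .def-neg = def-/ (def-* def-scale (def-neg X)) D
    Y .def-den = def-+ (def-den X) (def-* (def-size t) (def-+ (def-const 1) (def-den X)))
    Y .exact = H*k

    module _ (G : LGraph p) (e : Env s G) where
      a = pos X G e
      b = neg X G e
      r = recip (d G e)
      c = suc (den X G)

      F*k : (F G e * r) * fromℕ (suc (k G)) ≡ fromℕ (scale G ℕ.* a) * r - fromℕ (scale G ℕ.* b) * r
      F*k = begin
        (F G e * r) * fromℕ (scale G ℕ.* c)                       ≡⟨ cong ((F G e * r) *_) (fromℕ-* (scale G) c) ⟩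
        (F G e * r) * (fromℕ (scale G) * fromℕ c)                 ≡⟨ solve 4 (λ f r t c → (f :* r) :* (t :* c) := (t :* (f :* c)) :* r) refl (F G e) r (fromℕ (scale G)) (fromℕ c) ⟩
        (fromℕ (scale G) * (F G e * fromℕ c)) * r                 ≡⟨ cong (λ x → (fromℕ (scale G) * x) * r) (exact X G e) ⟩
        (fromℕ (scale G) * (fromℕ a - fromℕ b)) * r               ≡⟨ solve 4 (λ t a b r → (t :* (a :- b)) :* r := (t :* a) :* r :- (t :* b) :* r) refl (fromℕ (scale G)) (fromℕ a) (fromℕ b) r ⟩
        (fromℕ (scale G) * fromℕ a) * r - (fromℕ (scale G) * fromℕ b) * r
          ≡⟨ cong₂ (λ x y → x * r - y * r) (fromℕ-* (scale G) a) (fromℕ-* (scale G) b) ⟨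
        fromℕ (scale G ℕ.* a) * r - fromℕ (scale G ℕ.* b) * r         ∎
        where open ≡-Reasoning

      size≤k : size t G ℕ.≤ suc (k G)
      size≤k = ℕ.≤-trans (ℕ.n≤1+n (size t G)) (ℕ.m≤m*n (scale G) c)

      close : H G e ≈[ width t G ] F G e * r
      close = ≈-*ʳ-cancel (fromℕ (suc (k G))) {{fromℕ-pos (suc (k G))}}
        (subst₂ (_≈[ width t G * fromℕ (suc (k G)) ]_) (sym (H*k G e)) (sym F*k)
          (≈-weaken
            (ℚ.≤-trans (1≤ t G) (ℚ.*-monoˡ-≤-nonNeg (width t G) {{ℚ.nonNegative (0≤width t G)}} (fromℕ-mono-≤ size≤k)))
            (floor-difference (scale G ℕ.* a) (scale G ℕ.* b) (d G e))))

module _ {s : Scope} {F : (G : LGraph p) → Env s G → ℚ} where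

  -- Half of the tolerance goes to approximating F and half to rounding the quotient; division by a
  -- number at least 1 does not enlarge the first error.
  approx-/ : ∀ {d} → Approximable s F → Def s d → Approximable s (λ G e → F G e * recip (d G e))
  approx-/ {d} A D t =
    let H , X , h = A (halve t)
        K , Y , k = approx-exact-/ X D (halve t)
    in K , Y , λ G e → subst (K G e ≈[_] F G e * recip (d G e)) (halve-width t G)
         (≈-trans (k G e) (divided (d G e) (0≤width (halve t) G) (h G e)))
    where
    divided : ∀ {x y e} n → 0ℚ ≤ e → x ≈[ e ] y → x * recip n ≈[ e ] y * recip n
    divided {x} {y} {e} n 0≤e h = subst₂ (_≈[ e ]_) (ℚ.*-comm (recip n) x) (ℚ.*-comm (recip n) y)
      (≈-weaken (subst₂ _≤_ (cong (_* e) (sym (ℚ.0≤p⇒∣p∣≡p (ℚ.<⇒≤ (ℚ.positive⁻¹ (recip n) {{recip-pos n}})))))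
                            (ℚ.*-identityˡ e)
                  (ℚ.*-monoʳ-≤-nonNeg e {{ℚ.nonNegative 0≤e}} (recip≤1 n)))
                (≈-*ˡ (recip n) h))

  approx-scale : ∀ q → Approximable s F → Approximable s (λ G e → q * F G e)
  approx-scale q A t =
    let H , X , h = A (shrink t (def-const K))
    in (λ G e → q * H G e) , exact-* (exact-const q) X ,
       λ G e → ≈-weaken (bound G) (≈-*ˡ q (h G e))
    where
    -- The absolute value of the numerator bounds `∣ q ∣`, since the denominator is at least 1.
    K = ℤ.∣ ↥ q ∣

    ∣q∣≤K : ∀ q → ∣ q ∣ ≤ fromℕ ℤ.∣ ↥ q ∣
    ∣q∣≤K q@(mkℚ i d _) = subst₂ _≤_ (ℚ.*-identityʳ ∣ q ∣) (*-denominator ∣ q ∣)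
      (ℚ.*-monoˡ-≤-nonNeg ∣ q ∣ {{ℚ.∣-∣-nonNeg q}} (fromℕ-mono-≤ {1} {suc d} (s≤s z≤n)))

    bound : ∀ G → ∣ q ∣ * (width t G * recip K) ≤ width t G
    bound G = subst (∣ q ∣ * (width t G * recip K) ≤_) (shrink-width (width t G) K)
      (ℚ.*-monoʳ-≤-nonNeg _ {{ℚ.nonNegative (0≤width (shrink t (def-const K)) G)}}
        (ℚ.≤-trans (∣q∣≤K q) (fromℕ-mono-≤ (ℕ.n≤1+n K))))

module _ {F : (G : LGraph p) → V G → ℚ} (A : Approximable unary F) where

  approx-first : Approximable binary (λ G e → F G (proj₁ e))
  approx-first t = let H , X , h = A t in (λ G e → H G (proj₁ e)) , exact-first X , λ G e → h G (proj₁ e)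

  approx-second : Approximable binary (λ G e → F G (proj₂ e))
  approx-second t = let H , X , h = A t in (λ G e → H G (proj₂ e)) , exact-second X , λ G e → h G (proj₂ e)

degree≤order : ∀ (G : LGraph p) v → length (neighbours G v) ℕ.≤ order G
degree≤order G v = subst (length (neighbours G v) ℕ.≤_) (List.length-tabulate id)
  (List.length-filter (T? ∘ adj G v) (allFin (order G)))

-- `recip` adds one to its argument, so it receives the degree minus one. Without neighbours
-- truncation makes the divisor 1, and the empty sum yields the default 0 of mean.
aggregate-mean : ∀ {A : Set} (f : A → ℚ) ws →
  sumℚ (map f ws) * recip (∑ (map (const 1) ws) ℕ.∸ 1) ≡ aggregate mean (map f ws)
aggregate-mean f []       = refl
aggregate-mean f (w ∷ ws) = cong (λ n → sumℚ (map f (w ∷ ws)) * recip n) (count ws)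
  where
  count : ∀ us → ∑ (map (const 1) us) ≡ length (map f us)
  count []       = refl
  count (u ∷ us) = cong suc (count us)

module _ {F : (G : LGraph p) → V G × V G → ℚ} (A : Approximable binary F) where

  approx-sum : Approximable unary (λ G v → sumℚ (map (λ w → F G (v , w)) (neighbours G v)))
  approx-sum t =
    -- There are at most `order G` summands, each with error at most the width divided by `order G`
    -- + 1.
    let t′        = shrink t def-order
        H , X , h = A t′
    in _ , exact-sum X , λ G v → ≈-weaken
         (subst (fromℕ (length (neighbours G v)) * width t′ G ≤_) (shrink-width (width t G) (order G))
           (ℚ.*-monoʳ-≤-nonNeg _ {{ℚ.nonNegative (0≤width t′ G)}}
             (fromℕ-mono-≤ (ℕ.m≤n⇒m≤1+n (degree≤order G v)))))
         (≈-sumℚ (0≤width t′ G) (λ w → H G (v , w)) (λ w → F G (v , w)) (λ w → h G (v , w)) (neighbours G v))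

  approx-aggregate : ∀ a → Approximable unary (λ G v → aggregate a (map (λ w → F G (v , w)) (neighbours G v)))
  approx-aggregate sum    = approx-sum
  approx-aggregate mean   = approx-cong
    (λ G v → aggregate-mean (λ w → F G (v , w)) (neighbours G v))
    (approx-/ approx-sum (def-∸ (def-sum (def-const 1)) (def-const 1)))
  approx-aggregate max t =
    let H , X , h = A t
    in _ , exact-max X , λ G v →
         ≈-max (0≤width t G) (λ w → H G (v , w)) (λ w → F G (v , w)) (λ w → h G (v , w)) (neighbours G v)

-- Networks and layers preserve approximability

module _ {s : Scope} where

  approx-const : ∀ q → Approximable {p} s (λ _ _ → q)
  approx-const q = approx-exact (exact-const q)

  approx-sumℚ : ∀ {A : Set} {f : A → (G : LGraph p) → Env s G → ℚ} → (∀ u → Approximable s (f u)) →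
                ∀ us → Approximable s (λ G e → sumℚ (map (λ u → f u G e) us))
  approx-sumℚ A []       = approx-const 0ℚ
  approx-sumℚ A (u ∷ us) = approx-+ (A u) (approx-sumℚ A us)

  approx-at : ∀ {F : (G : LGraph p) → Env s G → ℚ} a → Approximable s F → Approximable s (λ G e → at a (F G e))
  approx-at (affine q c) A = approx-+ (approx-scale q A) (approx-const c)

  approx-neg : ∀ {F : (G : LGraph p) → Env s G → ℚ} → Approximable s F → Approximable s (λ G e → - F G e)
  approx-neg {F = F} A = approx-cong (λ G e → solve 1 (λ x → con (- 1ℚ) :* x := :- x) refl (F G e)) (approx-scale (- 1ℚ) A)

  -- Induction on the thresholds by `evalFrom-relu`. The remaining pieces are evaluated at
  -- `t + relu (F G e - t)` instead of F, hence the quantification over F after `Joined`.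
  approx-evalFrom : ∀ {a ps} → Joined a ps → ∀ {F : (G : LGraph p) → Env s G → ℚ} →
                    Approximable s F → Approximable s (λ G e → evalFrom a ps (F G e))
  approx-evalFrom {a = a} [] A = approx-at a A
  approx-evalFrom {a = a} (_∷_ {t = t} {a′} {ps} joint joined) {F} A =
    approx-cong (λ G e → sym (evalFrom-relu a t a′ ps joint (F G e)))
      (approx-+ (approx-at a (approx-+ A (approx-neg R)))
                (approx-+ (approx-evalFrom joined (approx-+ (approx-const t) R)) (approx-const (- at a t))))
    where
    R : Approximable s (λ G e → relu (F G e - t))
    R = approx-relu (approx-+ A (approx-const (- t)))

  approx-activation : ∀ {f} → Continuous f → RationalPL f → ∀ {F : (G : LGraph p) → Env s G → ℚ} →
                      Approximable s F → Approximable s (λ G e → f (F G e))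
  approx-activation cont (r , (rep , _) , _) {F} A =
    approx-cong (λ G e → sym (rep (F G e))) (approx-evalFrom (continuous⇒joined cont r rep) A)

  module _ {m n} (N : FNN m n) (pl : RationalPLFNN N) (x : (G : LGraph p) → Env s G → Vector ℚ m)
           (A : ∀ i → Approximable s (λ G e → x G e i)) where
    open FNN N using (Edge; edge; weight; bias; valueAcc; contribution; Edge-wellFounded; output; input)

    mutual
      -- Follows the recursion of `valueAcc` on accessibility, so the approximation is built node by
      -- node along the skeleton.
      approx-valueAcc : ∀ v (ac : Acc Edge v) → Approximable s (λ G e → valueAcc (x G e) v ac)
      approx-valueAcc v (acc rs) with Fin.any? (λ i → input i Fin.≟ v)
      ... | yes (i , _) = A i
      ... | no  _       = approx-activation (proj₁ (proj₂ (proj₂ pl) v)) (proj₂ (proj₂ (proj₂ pl) v))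
        (approx-+ (approx-const (bias v))
                  (approx-sumℚ (λ u → approx-contribution v rs u (T? (edge u v))) (allFin _)))

      approx-contribution : ∀ v (rs : ∀ {u} → Edge u v → Acc Edge u) u (d : Dec (Edge u v)) →
                            Approximable s (λ G e → contribution (x G e) v rs u d)
      approx-contribution v rs u (yes uv) = approx-scale (weight u v uv) (approx-valueAcc u (rs uv))
      approx-contribution v rs u (no _)   = approx-const 0ℚ

    approx-compute : ∀ j → Approximable s (λ G e → compute N (x G e) j)
    approx-compute j = approx-valueAcc (output j) (Edge-wellFounded (output j))

  approx-++ : ∀ {m n} {x : (G : LGraph p) → Env s G → Vector ℚ m} {y : (G : LGraph p) → Env s G → Vector ℚ n} →
              (∀ i → Approximable s (λ G e → x G e i)) → (∀ j → Approximable s (λ G e → y G e j)) →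
              ∀ k → Approximable s (λ G e → (x G e ++ y G e) k)
  approx-++ {m = m} A B k with splitAt m k
  ... | inj₁ i = A i
  ... | inj₂ j = B j

-- Messages are approximated in binary scope as functions of (v, w); aggregation over w returns to
-- unary scope, where the combination network is applied.
approx-runLayer : ∀ {m n} (L : Layer m n) → RationalPLFNN (Layer.msg L) → RationalPLFNN (Layer.comb L) →
  {x : (G : LGraph p) → Signal G m} → (∀ i → Approximable unary (λ G v → x G v i)) →
  ∀ j → Approximable unary (λ G v → runLayer L G (x G) v j)
approx-runLayer L msg-pl comb-pl {x} A = approx-compute comb comb-pl _
  (approx-++ A λ i → approx-cong
    (λ G v → cong (aggregate agg) (List.map-∘ (neighbours G v)))
    (approx-aggregate (approx-compute msg msg-pl (λ G e → x G (proj₁ e) ++ x G (proj₂ e))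
      (approx-++ (λ k → approx-first (A k)) (λ k → approx-second (A k))) i) agg))
  where open Layer L

approx-runGNN : ∀ {m n} {N : GNN m n} → RationalPLGNN N →
  {x : (G : LGraph p) → Signal G m} → (∀ i → Approximable unary (λ G v → x G v i)) →
  ∀ j → Approximable unary (λ G v → runGNN N G (x G) v j)
approx-runGNN ε A = A
approx-runGNN (_◅_ {L = L} (msg-pl , comb-pl) pl) A = approx-runGNN pl (approx-runLayer L msg-pl comb-pl A)

approx-label : ∀ (i : Fin p) → Approximable unary (λ G v → labelSignal G v i)
approx-label i = approx-exact (exact-cong (exact-ℕ (def-label i)) cast)
  where
  cast : ∀ G v → fromℕ (if label G v i then 1 else 0) ≡ labelSignal G v i
  cast G v with label G v i
  ... | true  = refl
  ... | false = refl

-- From approximation to a defining formula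

module _ {s : Scope} {F : (G : LGraph p) → Env s G → ℚ} (X : Exact s F) (G : LGraph p) (e : Env s G) where

  private
    c = fromℕ (suc (den X G))

    instance
      c-pos : Positive c
      c-pos = fromℕ-pos (suc (den X G))

      c-nonNeg : NonNegative c
      c-nonNeg = fromℕ-nonNeg (suc (den X G))

  0≤⇒neg≤pos : 0ℚ ≤ F G e → neg X G e ℕ.≤ pos X G e
  0≤⇒neg≤pos h = fromℕ-cancel-≤ (subst₂ _≤_ (ℚ.+-identityˡ b)
    (trans (cong (_+ b) (exact X G e)) (solve 2 (λ a b → (a :- b) :+ b := a) refl (fromℕ (pos X G e)) b))
    (ℚ.+-monoˡ-≤ b (subst (_≤ F G e * c) (ℚ.*-zeroˡ c) (ℚ.*-monoʳ-≤-nonNeg c h))))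
    where b = fromℕ (neg X G e)

  neg≤pos⇒0≤ : neg X G e ℕ.≤ pos X G e → 0ℚ ≤ F G e
  neg≤pos⇒0≤ h = ℚ.*-cancelʳ-≤-pos c (subst₂ _≤_ (sym (ℚ.*-zeroˡ c)) (sym (exact X G e))
    (subst (_≤ fromℕ (pos X G e) - b) (ℚ.+-inverseʳ b) (ℚ.+-monoˡ-≤ (- b) (fromℕ-mono-≤ h))))
    where b = fromℕ (neg X G e)

eighth : Tolerance p
eighth .width _ = + 1 / 8
eighth .size _ = 8
eighth .def-size = def-const 8
eighth .0≤width _ = ℚ.nonNegative⁻¹ (+ 1 / 8)
eighth .1≤ _ = ℚ.≤-refl

theorem1p4 : (p : ℕ) (Q : UnaryQuery p) →
    (Σ[ N ∈ GNN p 1 ] RationalPLGNN N × Computes N Q) →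
    Definable Q
theorem1p4 p Q (N , pl , computes) = φ , φ-free , φ-correct
  where
  approximation = approx-runGNN pl approx-label 0F eighth
  H = proj₁ approximation
  close = proj₂ (proj₂ approximation)
  -- Within error 1/8 the outputs become at least 5/8 or at most 3/8, so the sign of H - ½ gives the
  -- answer; it is read off by comparing the two numerators.
  X : Exact unary (λ G v → H G v - ½)
  X = exact-+ (proj₁ (proj₂ approximation)) (exact-const (- ½))

  φ : Formula p
  φ = term (def-neg X) x₁ ≼ term (def-pos X) x₁

  φ-free : ∀ z → FreeF z φ → z ≡ vertex x₁
  φ-free z = [ free (def-neg X) x₁ z , free (def-pos X) x₁ z ]′

  φ-correct : ∀ G (v : V G) (α : Assignment G) → vertexAt α x₁ ≡ v →
              ⟦ φ ⟧ᶠ α ≡ true ⇔ answer Q G v ≡ true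
  φ-correct G v α refl rewrite sem (def-neg X) x₁ α | sem (def-pos X) x₁ α = mk⇔ sound complete
    where
    sound : (neg X G v ℕ.≤ᵇ pos X G v) ≡ true → answer Q G v ≡ true
    sound h with answer Q G v in eq
    ... | true  = refl
    -- A negative answer gives H ≤ 1/4 + 1/8, hence 0 ≤ -1/8, which evaluation refutes.
    ... | false = ⊥-elim (ℚ.≤⇒≤ᵇ (ℚ.≤-trans
      (neg≤pos⇒0≤ X G v (ℕ.≤ᵇ⇒≤ (neg X G v) (pos X G v) (Equivalence.from T-≡ h)))
      (ℚ.+-monoˡ-≤ (- ½) (ℚ.≤-trans (≈⇒≤ (close G v)) (ℚ.+-monoˡ-≤ (+ 1 / 8) (proj₂ (computes G v) eq))))))
    complete : answer Q G v ≡ true → (neg X G v ℕ.≤ᵇ pos X G v) ≡ true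
    -- From 3/4 ≤ H + 1/8, subtracting 5/8 = ½ + 1/8 leaves 1/8 ≤ H - ½.
    complete h = Equivalence.to T-≡ (ℕ.≤⇒≤ᵇ (0≤⇒neg≤pos X G v (ℚ.≤-trans (ℚ.≤ᵇ⇒≤ tt)
      (subst (+ 3 / 4 - + 5 / 8 ≤_) (solve 1 (λ h → (h :+ con (+ 1 / 8)) :- con (+ 5 / 8) := h :- con ½) refl (H G v))
        (ℚ.+-monoˡ-≤ (- (+ 5 / 8)) (ℚ.≤-trans (proj₁ (computes G v) h) (≈⇒≤ (≈-sym (close G v)))))))))
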